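{- For every real number $\theta > 0$ there exists a constant $K_{\theta} > 0$, depending only on $\theta$, such that for every integer $n \ge 2$, if $n_1, n_2, \ldots, n_{\phi(n)}$ denote the $\phi(n)$ positive integers less than $n$ and relatively prime to $n$, then $$\left( \prod_{i=1}^{\phi(n)} R(n_i) \right)^{\frac{1}{\phi(n)}} > K_{\theta}\, R(n)^{ -\theta}\, n .$$
   Context: For a positive integer $n = p_1^{a_1} p_2^{a_2} \cdots p_\omega^{a_\omega}$ with distinct primes $p_1,\ldots,p_\omega$ and exponents $a_j \ge 1$, the radical of $n$ is $R(n) = p_1 p_2 \cdots p_\omega$, with $R(1) = 1$ (empty product). $\phi$ denotes Euler's totient function. -}

module Defs where

open import Algebra.Bundles using (CommutativeRing)
open import Data.Empty using (⊥; ⊥-elim)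
open import Data.Integer as ℤ using (ℤ; +_; -[1+_]; _⊖_)
import Data.Integer.Properties as ℤₚ
open import Data.List.Base using (List; map; filter; length; applyUpTo)
open import Data.List.Membership.Propositional using (_∈_)
open import Data.List.Membership.Propositional.Properties using (∈-filter⁺)
import Data.List.Relation.Unary.All as All
open import Data.List.Relation.Unary.All.Properties using (all-filter; map⁺)
open import Data.List.Relation.Unary.Any using (here; there)
open import Data.Nat as ℕ using (ℕ; zero; suc; z≤n; s≤s)
open import Data.Nat.Coprimality using (coprime?; 1-coprimeTo)
open import Data.Nat.Divisibility using (_∣?_)
open import Data.Nat.ListAction using (product)
open import Data.Nat.ListAction.Properties using (product≢0)
open import Data.Nat.Primality using (prime?; prime⇒nonZero)
import Data.Nat.Properties as ℕₚ
open import Data.Product using (∃; _×_; _,_; proj₁; proj₂)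
open import Data.Rational as ℚ
open import Data.Rational.Properties as ℚₚ hiding (_≟_)
import Data.Rational.Unnormalised as ℚᵘ
import Data.Rational.Unnormalised.Properties as ℚᵘₚ
open import Data.Rational.Solver using (module +-*-Solver)
open import Data.Sum using (_⊎_; inj₁; inj₂)
open import Relation.Binary.PropositionalEquality
open import Relation.Nullary using (Dec; yes; no)
open import Relation.Nullary.Decidable using (_×-dec_)

open import Algebra.Properties.CommutativeSemiring.Exp
  (CommutativeRing.commutativeSemiring +-*-commutativeRing)
  using (_^_; ^-homo-*; ^-assocʳ; ^-distrib-*)

-- The radical of n, as the product of the primes p ≤ n with p ∣ n.
R : ℕ → ℕ
R n = product (filter (λ p → prime? p ×-dec (p ∣? n)) (applyUpTo suc n))

φ : ℕ → ℕ
φ n = length (filter (λ k → coprime? k n) (applyUpTo suc n))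

totatives : ℕ → List ℕ
totatives n = filter (λ k → coprime? k n) (applyUpTo suc (n ℕ.∸ 1))

R-nonZero : ∀ n → ℕ.NonZero (R n)
R-nonZero n = product≢0
  (All.map (λ (p-prime , _) → prime⇒nonZero p-prime)
    (all-filter (λ p → prime? p ×-dec (p ∣? n)) (applyUpTo suc n)))

∏R-nonZero : ∀ ns → ℕ.NonZero (product (map R ns))
∏R-nonZero ns = product≢0 (map⁺ (All.universal R-nonZero ns))

φ-nonZero : ∀ {n} → 2 ℕ.≤ n → ℕ.NonZero (φ n)
φ-nonZero {suc n} _ =
  nonEmpty (∈-filter⁺ (λ k → coprime? k (suc n)) (here refl) (1-coprimeTo (suc n)))
  where
  nonEmpty : ∀ {k} {ks : List ℕ} → k ∈ ks → ℕ.NonZero (length ks)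
  nonEmpty (here _)  = _
  nonEmpty (there _) = _

module ℚ-Lemmas where

  0<⇒pos : ∀ {p} → 0ℚ < p → Positive p
  0<⇒pos = positive

  +-pos : ∀ {p q} → 0ℚ < p → 0ℚ < q → 0ℚ < p + q
  +-pos {p} {q} 0<p 0<q = positive⁻¹ (p + q) {{pos+pos⇒pos p {{0<⇒pos 0<p}} q {{0<⇒pos 0<q}}}}

  *-pos : ∀ {p q} → 0ℚ < p → 0ℚ < q → 0ℚ < p * q
  *-pos {p} {q} 0<p 0<q = positive⁻¹ (p * q) {{pos*pos⇒pos p {{0<⇒pos 0<p}} q {{0<⇒pos 0<q}}}}

  *-monoʳ-< : ∀ {r p q} → 0ℚ < r → p < q → r * p < r * q
  *-monoʳ-< {r} 0<r = *-monoʳ-<-pos r {{0<⇒pos 0<r}}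

  *-monoˡ-< : ∀ {r p q} → 0ℚ < r → p < q → p * r < q * r
  *-monoˡ-< {r} 0<r = *-monoˡ-<-pos r {{0<⇒pos 0<r}}

  *-monoʳ-≤ : ∀ {r p q} → 0ℚ ≤ r → p ≤ q → r * p ≤ r * q
  *-monoʳ-≤ {r} 0≤r = *-monoˡ-≤-nonNeg r {{nonNegative 0≤r}}

  *-monoˡ-≤ : ∀ {r p q} → 0ℚ ≤ r → p ≤ q → p * r ≤ q * r
  *-monoˡ-≤ {r} 0≤r = *-monoʳ-≤-nonNeg r {{nonNegative 0≤r}}

  *-mono-≤ : ∀ {p q r s} → 0ℚ ≤ p → 0ℚ ≤ s → p ≤ q → r ≤ s → p * r ≤ q * s
  *-mono-≤ 0≤p 0≤s p≤q r≤s = ≤-trans (*-monoʳ-≤ 0≤p r≤s) (*-monoˡ-≤ 0≤s p≤q)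

  p<q⇒0<q-p : ∀ {p q} → p < q → 0ℚ < q - p
  p<q⇒0<q-p {p} {q} p<q = subst (_< q - p) (+-inverseʳ p) (+-monoˡ-< (- p) p<q)

  p<p+r : ∀ {p r} → 0ℚ < r → p < p + r
  p<p+r {p} {r} 0<r = subst (_< p + r) (+-identityʳ p) (+-monoʳ-< p 0<r)

  p-1<p : ∀ p → p - 1ℚ < p
  p-1<p p = subst (p - 1ℚ <_) (+-identityʳ p) (+-monoʳ-< p (negative⁻¹ (- 1ℚ)))

  0<1 : 0ℚ < 1ℚ
  0<1 = positive⁻¹ 1ℚ

  quot : ∀ p {r} → 0ℚ < r → ∃ λ s → r * s ≡ p
  quot p {r} 0<r = 1/r * p ,
    (begin
      r * (1/r * p)  ≡⟨ *-assoc r 1/r p ⟨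
      (r * 1/r) * p  ≡⟨ cong (_* p) (*-inverseʳ r {{r≢0}}) ⟩
      1ℚ * p         ≡⟨ *-identityˡ p ⟩
      p              ∎)
    where
    open ≡-Reasoning
    r≢0 : NonZero r
    r≢0 = pos⇒nonZero r {{0<⇒pos 0<r}}
    1/r = (1/ r) {{r≢0}}

  *-cancel-< : ∀ {r p q} → 0ℚ < r → r * p < r * q → p < q
  *-cancel-< {r} 0<r = *-cancelˡ-<-nonNeg r {{pos⇒nonNeg r {{0<⇒pos 0<r}}}}

  quot-pos : ∀ {p r s} → 0ℚ < r → r * s ≡ p → 0ℚ < p → 0ℚ < s
  quot-pos {p} {r} {s} 0<r rs≡p 0<p =
    *-cancel-< {r} {0ℚ} {s} 0<r (≤-<-trans (≤-reflexive (*-zeroʳ r)) (<-≤-trans 0<p (≤-reflexive (sym rs≡p))))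

  fromℕ-suc : ∀ n → (+ suc n) / 1 ≡ 1ℚ + (+ n) / 1
  fromℕ-suc n = toℚᵘ-injective (begin
    toℚᵘ ((+ suc n) / 1)                     ≈⟨ toℚᵘ-fromℚᵘ (ℚᵘ.mkℚᵘ (+ suc n) 0) ⟩
    ℚᵘ.mkℚᵘ (+ suc n) 0                      ≈⟨ ℚᵘ.*≡* (cong (ℤ._* + 1) lemma) ⟩
    ℚᵘ.1ℚᵘ ℚᵘ.+ ℚᵘ.mkℚᵘ (+ n) 0              ≈⟨ ℚᵘₚ.+-congʳ ℚᵘ.1ℚᵘ (toℚᵘ-fromℚᵘ (ℚᵘ.mkℚᵘ (+ n) 0)) ⟨
    toℚᵘ 1ℚ ℚᵘ.+ toℚᵘ ((+ n) / 1)            ≈⟨ toℚᵘ-homo-+ 1ℚ ((+ n) / 1) ⟨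
    toℚᵘ (1ℚ + (+ n) / 1)                    ∎)
    where
    open ℚᵘₚ.≃-Reasoning
    lemma : + suc n ≡ + 1 ℤ.+ + n ℤ.* + 1
    lemma = cong (λ z → + 1 ℤ.+ z) (sym (ℤₚ.*-identityʳ (+ n)))

  0≤fromℕ : ∀ n → 0ℚ ≤ (+ n) / 1
  0≤fromℕ n = nonNegative⁻¹ ((+ n) / 1) {{normalize-nonNeg n 1}}

  ≤fromℕ : ∀ p → ∃ λ n → p ≤ (+ n) / 1
  ≤fromℕ p@(mkℚ (+ n) d-1 _) = n , toℚᵘ-cancel-≤ (ℚᵘₚ.≤-respʳ-≃ (ℚᵘₚ.≃-sym (toℚᵘ-fromℚᵘ (ℚᵘ.mkℚᵘ (+ n) 0)))
    (ℚᵘ.*≤* (ℤₚ.*-monoˡ-≤-nonNeg (+ n) (ℤ.+≤+ (s≤s z≤n)))))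
  ≤fromℕ p@(mkℚ -[1+ n ] d-1 _) = 0 , <⇒≤ (negative⁻¹ p)

  archimedean : ∀ p {r} → 0ℚ < r → ∃ λ n → p ≤ (+ n) / 1 * r
  archimedean p {r} 0<r with quot p 0<r
  ... | s , rs≡p with ≤fromℕ s
  ... | n , s≤n = n , subst (_≤ (+ n) / 1 * r) (trans (*-comm s r) rs≡p) (*-monoˡ-≤ (<⇒≤ 0<r) s≤n)

  ⊓-elim : ∀ {ℓ} (P : ℚ → Set ℓ) {p q} → P p → P q → P (p ⊓ q)
  ⊓-elim P {p} {q} Pp Pq with ⊓-sel p q
  ... | inj₁ e = subst P (sym e) Pp
  ... | inj₂ e = subst P (sym e) Pq

  ⊔-elim : ∀ {ℓ} (P : ℚ → Set ℓ) {p q} → P p → P q → P (p ⊔ q)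
  ⊔-elim P {p} {q} Pp Pq with ⊔-sel p q
  ... | inj₁ e = subst P (sym e) Pp
  ... | inj₂ e = subst P (sym e) Pq

  neg-involutive : ∀ p → - (- p) ≡ p
  neg-involutive = solve 1 (λ p → :- (:- p) := p) refl where open +-*-Solver

  module _ (w x y z : ℚ) where
    min₄ max₄ : ℚ
    min₄ = (w ⊓ x) ⊓ (y ⊓ z)
    max₄ = (w ⊔ x) ⊔ (y ⊔ z)

    min₄-≤ : min₄ ≤ w × min₄ ≤ x × min₄ ≤ y × min₄ ≤ z
    min₄-≤ =
      ≤-trans (p⊓q≤p (w ⊓ x) (y ⊓ z)) (p⊓q≤p w x) ,
      ≤-trans (p⊓q≤p (w ⊓ x) (y ⊓ z)) (p⊓q≤q w x) ,
      ≤-trans (p⊓q≤q (w ⊓ x) (y ⊓ z)) (p⊓q≤p y z) ,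
      ≤-trans (p⊓q≤q (w ⊓ x) (y ⊓ z)) (p⊓q≤q y z)

    max₄-≥ : w ≤ max₄ × x ≤ max₄ × y ≤ max₄ × z ≤ max₄
    max₄-≥ =
      ≤-trans (p≤p⊔q w x) (p≤p⊔q (w ⊔ x) (y ⊔ z)) ,
      ≤-trans (p≤q⊔p w x) (p≤p⊔q (w ⊔ x) (y ⊔ z)) ,
      ≤-trans (p≤p⊔q y z) (p≤q⊔p (w ⊔ x) (y ⊔ z)) ,
      ≤-trans (p≤q⊔p y z) (p≤q⊔p (w ⊔ x) (y ⊔ z))

    <-min₄ : ∀ {q} → q < w × q < x × q < y × q < z → q < min₄
    <-min₄ {q} (q<w , q<x , q<y , q<z) =
      ⊓-elim (q <_) (⊓-elim (q <_) q<w q<x) (⊓-elim (q <_) q<y q<z)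

    max₄-< : ∀ {q} → w < q × x < q × y < q × z < q → max₄ < q
    max₄-< {q} (w<q , x<q , y<q , z<q) =
      ⊔-elim (_< q) (⊔-elim (_< q) w<q x<q) (⊔-elim (_< q) y<q z<q)

    <min₄⇒ : ∀ {q} → q < min₄ → q < w × q < x × q < y × q < z
    <min₄⇒ q<m with min₄-≤
    ... | m≤w , m≤x , m≤y , m≤z =
      <-≤-trans q<m m≤w , <-≤-trans q<m m≤x , <-≤-trans q<m m≤y , <-≤-trans q<m m≤z

    max₄<⇒ : ∀ {q} → max₄ < q → w < q × x < q × y < q × z < q
    max₄<⇒ m<q with max₄-≥
    ... | w≤m , x≤m , y≤m , z≤m =
      ≤-<-trans w≤m m<q , ≤-<-trans x≤m m<q , ≤-<-trans y≤m m<q , ≤-<-trans z≤m m<q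

  -- On a box [a , b] × [c , d] the extrema of a product are attained at corners.
  corners-< : ∀ {a b c d u v q} → a ≤ u → u ≤ b → c ≤ v → v ≤ d →
              q < a * c × q < a * d × q < b * c × q < b * d → q < u * v
  corners-< {a} {b} {c} {d} {u} {v} {q} a≤u u≤b c≤v v≤d (q<ac , q<ad , q<bc , q<bd)
    with ≤-total 0ℚ v
  ... | inj₁ 0≤v = <-≤-trans (q<tv {a} q<ac q<ad) (*-monoˡ-≤ 0≤v a≤u)
    where
    q<tv : ∀ {t} → q < t * c → q < t * d → q < t * v
    q<tv {t} q<tc q<td with ≤-total 0ℚ t
    ... | inj₁ 0≤t = <-≤-trans q<tc (*-monoʳ-≤ 0≤t c≤v)
    ... | inj₂ t≤0 = <-≤-trans q<td (*-monoˡ-≤-nonPos t {{nonPositive t≤0}} v≤d)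
  ... | inj₂ v≤0 = <-≤-trans (q<tv {b} q<bc q<bd) (*-monoʳ-≤-nonPos v {{nonPositive v≤0}} u≤b)
    where
    q<tv : ∀ {t} → q < t * c → q < t * d → q < t * v
    q<tv {t} q<tc q<td with ≤-total 0ℚ t
    ... | inj₁ 0≤t = <-≤-trans q<tc (*-monoʳ-≤ 0≤t c≤v)
    ... | inj₂ t≤0 = <-≤-trans q<td (*-monoˡ-≤-nonPos t {{nonPositive t≤0}} v≤d)

  corners-> : ∀ {a b c d u v q} → a ≤ u → u ≤ b → c ≤ v → v ≤ d →
              a * c < q × a * d < q × b * c < q × b * d < q → u * v < q
  corners-> {a} {b} {c} {d} {u} {v} {q} a≤u u≤b c≤v v≤d (ac<q , ad<q , bc<q , bd<q) =
    neg-cancel-< (subst (- q <_) (sym (neg-distribˡ-* u v))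
      (corners-< (neg-antimono-≤ u≤b) (neg-antimono-≤ a≤u) c≤v v≤d
        (negate b c bc<q , negate b d bd<q , negate a c ac<q , negate a d ad<q)))
    where
    neg-cancel-< : ∀ {p r} → - p < - r → r < p
    neg-cancel-< {p} {r} -p<-r = subst₂ _<_ (neg-involutive r) (neg-involutive p) (neg-antimono-< -p<-r)
    negate : ∀ s t → s * t < q → - q < - s * t
    negate s t st<q = subst (- q <_) (neg-distribˡ-* s t) (neg-antimono-< st<q)

  bounded-* : ∀ {m ε u v} → - m ≤ u → u ≤ m → 0ℚ < m → 0ℚ < v → v < ε →
              - (m * ε) < u * v × u * v < m * ε
  bounded-* {m} {ε} {u} {v} -m≤u u≤m 0<m 0<v v<ε =
    <-≤-trans (subst (- (m * ε) <_) (neg-distribˡ-* m v) (neg-antimono-< mv<mε)) (*-monoˡ-≤ (<⇒≤ 0<v) -m≤u) ,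
    ≤-<-trans (*-monoˡ-≤ (<⇒≤ 0<v) u≤m) mv<mε
    where
    mv<mε : m * v < m * ε
    mv<mε = *-monoʳ-< 0<m v<ε

  threshold : ∀ p q w m ε → ((m + m) + (m + m)) * ε ≡ q - p →
              w - (m * ε + m * ε) < p → w + (m * ε + m * ε) < q
  threshold p q w m ε e w-2δ<p = begin-strict
    w + (m * ε + m * ε)                                ≡⟨ lhs w m ε ⟨
    w - (m * ε + m * ε) + ((m + m) + (m + m)) * ε      <⟨ +-monoˡ-< (((m + m) + (m + m)) * ε) w-2δ<p ⟩
    p + ((m + m) + (m + m)) * ε                        ≡⟨ cong (_+_ p) e ⟩
    p + (q - p)                                        ≡⟨ rhs p q ⟩
    q                                                  ∎
    where
    open ≤-Reasoning
    lhs : ∀ w m ε → w - (m * ε + m * ε) + ((m + m) + (m + m)) * ε ≡ w + (m * ε + m * ε)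
    lhs = solve 3 (λ w m ε → w :- (m :* ε :+ m :* ε) :+ ((m :+ m) :+ (m :+ m)) :* ε
                           := w :+ (m :* ε :+ m :* ε)) refl where open +-*-Solver
    rhs : ∀ p q → p + (q - p) ≡ q
    rhs = solve 2 (λ p q → p :+ (q :- p) := q) refl where open +-*-Solver

  numerators-< : ∀ r r′ n → r′ < r + (+ 1) / suc n →
    ↥ r′ ℤ.* + (↧ₙ r ℕ.* suc n) ℤ.< (↥ r ℤ.* + suc n ℤ.+ + 1 ℤ.* + ↧ₙ r) ℤ.* + ↧ₙ r′
  numerators-< r@(mkℚ _ _ _) r′@(mkℚ _ _ _) n r′<r+1/T =
    ℚᵘₚ.drop-*<* {toℚᵘ r′} {toℚᵘ r ℚᵘ.+ ℚᵘ.mkℚᵘ (+ 1) n} (ℚᵘₚ.<-respʳ-≃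
      (ℚᵘₚ.≃-trans (toℚᵘ-homo-+ r ((+ 1) / suc n))
        (ℚᵘₚ.+-congʳ (toℚᵘ r) (toℚᵘ-fromℚᵘ (ℚᵘ.mkℚᵘ (+ 1) n))))
      (toℚᵘ-mono-< r′<r+1/T))

  ^-pos : ∀ {p} n → 0ℚ < p → 0ℚ < p ^ n
  ^-pos zero    0<p = 0<1
  ^-pos (suc n) 0<p = *-pos 0<p (^-pos n 0<p)

  ^-nonNeg : ∀ {p} n → 0ℚ ≤ p → 0ℚ ≤ p ^ n
  ^-nonNeg zero    0≤p = <⇒≤ 0<1
  ^-nonNeg {p} (suc n) 0≤p = subst (_≤ p * p ^ n) (*-zeroʳ p) (*-monoʳ-≤ 0≤p (^-nonNeg n 0≤p))

  ^-mono-≤ : ∀ {p q} n → 0ℚ ≤ p → p ≤ q → p ^ n ≤ q ^ n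
  ^-mono-≤ zero    0≤p p≤q = ≤-refl
  ^-mono-≤ (suc n) 0≤p p≤q = *-mono-≤ 0≤p (^-nonNeg n (≤-trans 0≤p p≤q)) p≤q (^-mono-≤ n 0≤p p≤q)

  ^-mono-< : ∀ {p q} n → 0ℚ ≤ p → p < q → p ^ suc n < q ^ suc n
  ^-mono-< {p} {q} n 0≤p p<q = ≤-<-trans (*-monoʳ-≤ 0≤p (^-mono-≤ n 0≤p (<⇒≤ p<q)))
    (*-monoˡ-< (^-pos n (≤-<-trans 0≤p p<q)) p<q)

  ^-cancel-< : ∀ {p q} n → 0ℚ ≤ q → p ^ n < q ^ n → p < q
  ^-cancel-< {p} {q} n 0≤q pⁿ<qⁿ with p <? q
  ... | yes p<q = p<q
  ... | no  p≮q = ⊥-elim (<-irrefl refl (<-≤-trans pⁿ<qⁿ (^-mono-≤ n 0≤q (≮⇒≥ p≮q))))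

  1≤^ : ∀ {p} n → 1ℚ ≤ p → 1ℚ ≤ p ^ n
  1≤^ zero    1≤p = ≤-refl
  1≤^ {p} (suc n) 1≤p = *-mono-≤ (<⇒≤ 0<1) (^-nonNeg n (≤-trans (<⇒≤ 0<1) 1≤p)) 1≤p (1≤^ n 1≤p)

  p≤p^ : ∀ {p} n → 1ℚ ≤ p → p ≤ p ^ suc n
  p≤p^ {p} n 1≤p = subst (_≤ p * p ^ n) (*-identityʳ p) (*-monoʳ-≤ (≤-trans (<⇒≤ 0<1) 1≤p) (1≤^ n 1≤p))

  p^≤p : ∀ {p} n → 0ℚ ≤ p → p ≤ 1ℚ → p ^ suc n ≤ p
  p^≤p {p} n 0≤p p≤1 = subst (p * p ^ n ≤_) (*-identityʳ p) (*-monoʳ-≤ 0≤p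
    (subst (p ^ n ≤_) (1^ n) (^-mono-≤ n 0≤p p≤1)))
    where
    1^ : ∀ n → 1ℚ ^ n ≡ 1ℚ
    1^ zero    = refl
    1^ (suc n) = trans (*-identityˡ (1ℚ ^ n)) (1^ n)

  bernoulli : ∀ {d} n → 0ℚ ≤ d → 1ℚ + (+ n) / 1 * d ≤ (1ℚ + d) ^ n
  bernoulli {d} zero    0≤d = ≤-reflexive (trans (cong (_+_ 1ℚ) (*-zeroˡ d)) (+-identityʳ 1ℚ))
  bernoulli {d} (suc n) 0≤d = begin
    1ℚ + (+ suc n) / 1 * d                 ≡⟨ cong (λ m → 1ℚ + m * d) (fromℕ-suc n) ⟩
    1ℚ + (1ℚ + k) * d                      ≡⟨ +-identityʳ _ ⟨
    1ℚ + (1ℚ + k) * d + 0ℚ                 ≤⟨ +-monoʳ-≤ (1ℚ + (1ℚ + k) * d) 0≤kdd ⟩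
    1ℚ + (1ℚ + k) * d + k * d * d          ≡⟨ expand k d ⟩
    (1ℚ + d) * (1ℚ + k * d)                ≤⟨ *-monoʳ-≤ 0≤1+d (bernoulli n 0≤d) ⟩
    (1ℚ + d) * (1ℚ + d) ^ n                ∎
    where
    open ≤-Reasoning
    k = (+ n) / 1
    0≤1+d : 0ℚ ≤ 1ℚ + d
    0≤1+d = ≤-trans (<⇒≤ 0<1) (subst (_≤ 1ℚ + d) (+-identityʳ 1ℚ) (+-monoʳ-≤ 1ℚ 0≤d))
    0≤kdd : 0ℚ ≤ k * d * d
    0≤kdd = subst (_≤ k * d * d) (*-zeroˡ d)
      (*-monoˡ-≤ 0≤d (subst (_≤ k * d) (*-zeroˡ d) (*-monoˡ-≤ 0≤d (0≤fromℕ n))))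
    expand : ∀ k d → 1ℚ + (1ℚ + k) * d + k * d * d ≡ (1ℚ + d) * (1ℚ + k * d)
    expand = solve 2 (λ k d → con 1ℚ :+ (con 1ℚ :+ k) :* d :+ k :* d :* d
                            := (con 1ℚ :+ d) :* (con 1ℚ :+ k :* d)) refl
      where open +-*-Solver

  ^-outgrows : ∀ {p q} x → 0ℚ < p → p < q → ∃ λ n → p ^ suc n * x < q ^ suc n
  ^-outgrows {p} {q} x 0<p p<q = outgrows (proj₁ d∃) (proj₂ d∃)
    (archimedean x (quot-pos 0<p (proj₂ d∃) (p<q⇒0<q-p p<q)))
    where
    d∃ : ∃ λ d → p * d ≡ q - p
    d∃ = quot (q - p) 0<p
    outgrows : ∀ d → p * d ≡ q - p → (∃ λ n → x ≤ (+ n) / 1 * d) → ∃ λ n → p ^ suc n * x < q ^ suc n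
    outgrows d pd≡q-p (n , x≤nd) = n , (begin-strict
     p ^ suc n * x                        ≤⟨ *-monoʳ-≤ 0≤pⁿ x≤nd ⟩
     p ^ suc n * (k * d)                  <⟨ *-monoʳ-< (^-pos (suc n) 0<p) kd<1+[1+k]d ⟩
     p ^ suc n * (1ℚ + (+ suc n) / 1 * d) ≤⟨ *-monoʳ-≤ 0≤pⁿ (bernoulli (suc n) (<⇒≤ 0<d)) ⟩
     p ^ suc n * (1ℚ + d) ^ suc n         ≡⟨ ^-distrib-* p (1ℚ + d) (suc n) ⟨
     (p * (1ℚ + d)) ^ suc n               ≡⟨ cong (_^ suc n) p[1+d]≡q ⟩
     q ^ suc n                            ∎)
     where
     open ≤-Reasoning
     k = (+ n) / 1
     0<d : 0ℚ < d
     0<d = quot-pos 0<p pd≡q-p (p<q⇒0<q-p p<q)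
     0≤pⁿ : 0ℚ ≤ p ^ suc n
     0≤pⁿ = <⇒≤ (^-pos (suc n) 0<p)
     rearrange : ∀ k d → k * d + (1ℚ + d) ≡ 1ℚ + (1ℚ + k) * d
     rearrange = solve 2 (λ k d → k :* d :+ (con 1ℚ :+ d) := con 1ℚ :+ (con 1ℚ :+ k) :* d) refl
       where open +-*-Solver
     kd<1+[1+k]d : k * d < 1ℚ + (+ suc n) / 1 * d
     kd<1+[1+k]d = subst (k * d <_)
       (trans (rearrange k d) (cong (λ m → 1ℚ + m * d) (sym (fromℕ-suc n))))
       (p<p+r (+-pos 0<1 0<d))
     p[1+d]≡q : p * (1ℚ + d) ≡ q
     p[1+d]≡q = trans (*-distribˡ-+ p 1ℚ d) (trans (cong₂ _+_ (*-identityʳ p) pd≡q-p) (cancel p q))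
       where
       cancel : ∀ p q → p + (q - p) ≡ q
       cancel = solve 2 (λ p q → p :+ (q :- p) := q) refl where open +-*-Solver

  ^-open-< : ∀ {q B} n → 0ℚ < q → q ^ n < B → ∃ λ r → q < r × r ^ n < B
  ^-open-< {q} zero    0<q 1<B = q + 1ℚ , p<p+r 0<1 , 1<B
  ^-open-< {q} {B} (suc n) 0<q qqⁿ<B with quot B 0<q
  ... | B/q , q[B/q]≡B with <-dense (*-cancel-< 0<q (subst (q * q ^ n <_) (sym q[B/q]≡B) qqⁿ<B))
  ... | C , qⁿ<C , C<B/q with ^-open-< n 0<q qⁿ<C | quot B (<-trans (^-pos n 0<q) qⁿ<C)
  ... | r₁ , q<r₁ , r₁ⁿ<C | B/C , C[B/C]≡B with <-dense (⊓-elim (q <_) q<r₁ q<B/C)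
    where
    q<B/C : q < B/C
    q<B/C = *-cancel-< (<-trans (^-pos n 0<q) qⁿ<C)
      (subst₂ _<_ (*-comm q C) (trans q[B/q]≡B (sym C[B/C]≡B)) (*-monoʳ-< 0<q C<B/q))
  ... | r , q<r , r<m = r , q<r , (begin-strict
    r * r ^ n  ≤⟨ *-monoʳ-≤ 0≤r (^-mono-≤ n 0≤r (<⇒≤ r<r₁)) ⟩
    r * r₁ ^ n ≤⟨ *-monoʳ-≤ 0≤r (<⇒≤ r₁ⁿ<C) ⟩
    r * C      <⟨ *-monoˡ-< 0<C (<-≤-trans r<m (p⊓q≤q r₁ B/C)) ⟩
    B/C * C    ≡⟨ *-comm B/C C ⟩
    C * B/C    ≡⟨ C[B/C]≡B ⟩
    B          ∎)
    where
    open ≤-Reasoning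
    0<C : 0ℚ < C
    0<C = <-trans (^-pos n 0<q) qⁿ<C
    0≤r : 0ℚ ≤ r
    0≤r = <⇒≤ (<-trans 0<q q<r)
    r<r₁ : r < r₁
    r<r₁ = <-≤-trans r<m (p⊓q≤p r₁ B/C)

  ^-open-> : ∀ {q B} n → 0ℚ < q → 0ℚ < B → B < q ^ n → ∃ λ r → 0ℚ < r × r < q × B < r ^ n
  ^-open-> {q} zero    0<q 0<B B<1 with <-dense 0<q
  ... | r , 0<r , r<q = r , 0<r , r<q , B<1
  ^-open-> {q} {B} (suc n) 0<q 0<B B<qqⁿ with quot B 0<q
  ... | B/q , q[B/q]≡B with <-dense (*-cancel-< 0<q (subst (_< q * q ^ n) (sym q[B/q]≡B) B<qqⁿ))
  ... | C , B/q<C , C<qⁿ with ^-open-> n 0<q 0<C C<qⁿ | quot B 0<C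
    where
    0<C : 0ℚ < C
    0<C = <-trans (quot-pos 0<q q[B/q]≡B 0<B) B/q<C
  ... | r₁ , 0<r₁ , r₁<q , C<r₁ⁿ | B/C , C[B/C]≡B with <-dense (⊔-elim (_< q) r₁<q B/C<q)
    where
    0<C : 0ℚ < C
    0<C = <-trans (quot-pos 0<q q[B/q]≡B 0<B) B/q<C
    B/C<q : B/C < q
    B/C<q = *-cancel-< 0<C
      (subst₂ _<_ (trans q[B/q]≡B (sym C[B/C]≡B)) (*-comm q C) (*-monoʳ-< 0<q B/q<C))
  ... | r , m<r , r<q = r , 0<r , r<q , (begin-strict
    B          ≡⟨ C[B/C]≡B ⟨
    C * B/C    ≡⟨ *-comm C B/C ⟩
    B/C * C    <⟨ *-monoˡ-< 0<C (≤-<-trans (p≤q⊔p r₁ B/C) m<r) ⟩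
    r * C      ≤⟨ *-monoʳ-≤ (<⇒≤ 0<r) (<⇒≤ C<r₁ⁿ) ⟩
    r * r₁ ^ n ≤⟨ *-monoʳ-≤ (<⇒≤ 0<r) (^-mono-≤ n (<⇒≤ 0<r₁) (<⇒≤ r₁<r)) ⟩
    r * r ^ n  ∎)
    where
    open ≤-Reasoning
    0<C : 0ℚ < C
    0<C = <-trans (quot-pos 0<q q[B/q]≡B 0<B) B/q<C
    r₁<r : r₁ < r
    r₁<r = ≤-<-trans (p≤p⊔q r₁ B/C) m<r
    0<r : 0ℚ < r
    0<r = <-trans 0<r₁ r₁<r

infixr 8 _^ℤ_

_^ℤ_ : (p : ℚ) .{{_ : NonZero p}} → ℤ → ℚ
p ^ℤ (+ n)    = p ^ n
p ^ℤ -[1+ n ] = (1/ p) ^ suc n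

module ℤ-Power-Lemmas {x : ℚ} (1≤x : 1ℚ ≤ x) .{{_ : NonZero x}} where

  open ℚ-Lemmas

  0<x : 0ℚ < x
  0<x = <-≤-trans 0<1 1≤x

  private
    0<1/x : 0ℚ < 1/ x
    0<1/x = quot-pos 0<x (*-inverseʳ x) 0<1

    ^ℤ-⊖ : ∀ m n → x ^ℤ (m ⊖ n) ≡ x ^ m * (1/ x) ^ n
    ^ℤ-⊖ m       zero    = sym (*-identityʳ (x ^ m))
    ^ℤ-⊖ zero    (suc n) = sym (*-identityˡ ((1/ x) ^ suc n))
    ^ℤ-⊖ (suc m) (suc n) = begin
      x ^ℤ (suc m ⊖ suc n)                       ≡⟨ cong (x ^ℤ_) (ℤₚ.[1+m]⊖[1+n]≡m⊖n m n) ⟩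
      x ^ℤ (m ⊖ n)                               ≡⟨ ^ℤ-⊖ m n ⟩
      x ^ m * (1/ x) ^ n                         ≡⟨ *-identityˡ _ ⟨
      1ℚ * (x ^ m * (1/ x) ^ n)                  ≡⟨ cong (_* (x ^ m * (1/ x) ^ n)) (*-inverseʳ x) ⟨
      x * (1/ x) * (x ^ m * (1/ x) ^ n)          ≡⟨ interchange x (1/ x) (x ^ m) ((1/ x) ^ n) ⟩
      x * x ^ m * ((1/ x) * (1/ x) ^ n)          ∎
      where
      open ≡-Reasoning
      interchange : ∀ a b c d → a * b * (c * d) ≡ a * c * (b * d)
      interchange = solve 4 (λ a b c d → a :* b :* (c :* d) := a :* c :* (b :* d)) refl
        where open +-*-Solver

  ^ℤ-pos : ∀ i → 0ℚ < x ^ℤ i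
  ^ℤ-pos (+ n)    = ^-pos n 0<x
  ^ℤ-pos -[1+ n ] = ^-pos (suc n) 0<1/x

  ^ℤ-homo-+ : ∀ i j → x ^ℤ (i ℤ.+ j) ≡ x ^ℤ i * x ^ℤ j
  ^ℤ-homo-+ (+ m)    (+ n)    = ^-homo-* x m n
  ^ℤ-homo-+ (+ m)    -[1+ n ] = ^ℤ-⊖ m (suc n)
  ^ℤ-homo-+ -[1+ m ] (+ n)    = trans (^ℤ-⊖ n (suc m)) (*-comm (x ^ n) ((1/ x) ^ suc m))
  ^ℤ-homo-+ -[1+ m ] -[1+ n ] =
    trans (cong ((1/ x) ^_) (cong suc (sym (ℕₚ.+-suc m n)))) (^-homo-* (1/ x) (suc m) (suc n))

  ^ℤ-assoc : ∀ i n → (x ^ℤ i) ^ n ≡ x ^ℤ (i ℤ.* + n)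
  ^ℤ-assoc i zero    = cong (x ^ℤ_) (sym (ℤₚ.*-zeroʳ i))
  ^ℤ-assoc i (suc n) = begin
    x ^ℤ i * (x ^ℤ i) ^ n       ≡⟨ cong (x ^ℤ i *_) (^ℤ-assoc i n) ⟩
    x ^ℤ i * x ^ℤ (i ℤ.* + n)   ≡⟨ ^ℤ-homo-+ i (i ℤ.* + n) ⟨
    x ^ℤ (i ℤ.+ i ℤ.* + n)      ≡⟨ cong (x ^ℤ_) (ℤₚ.*-suc i (+ n)) ⟨
    x ^ℤ (i ℤ.* + suc n)        ∎
    where open ≡-Reasoning

  ^ℤ-mono-≤ : ∀ {i j} → i ℤ.≤ j → x ^ℤ i ≤ x ^ℤ j
  ^ℤ-mono-≤ {i} {j} i≤j = begin
    x ^ℤ i                    ≡⟨ *-identityʳ (x ^ℤ i) ⟨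
    x ^ℤ i * 1ℚ               ≤⟨ *-monoʳ-≤ (<⇒≤ (^ℤ-pos i)) (1≤^ k 1≤x) ⟩
    x ^ℤ i * x ^ k            ≡⟨ ^ℤ-homo-+ i (+ k) ⟨
    x ^ℤ (i ℤ.+ + k)          ≡⟨ cong (x ^ℤ_) i+k≡j ⟩
    x ^ℤ j                    ∎
    where
    open ≤-Reasoning
    k = ℤ.∣ j ℤ.- i ∣
    i+k≡j : i ℤ.+ + k ≡ j
    i+k≡j = trans (cong (ℤ._+_ i) (ℤₚ.0≤i⇒+∣i∣≡i (ℤₚ.i≤j⇒0≤j-i i≤j)))
      (trans (ℤₚ.+-comm i (j ℤ.- i))
        (trans (ℤₚ.+-assoc j (ℤ.- i) i)
          (trans (cong (ℤ._+_ j) (ℤₚ.+-inverseˡ i)) (ℤₚ.+-identityʳ j))))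


-- Real numbers as two-sided Dedekind cuts: L x q means q < x and
-- U x q means x < q.

record ℝ : Set₁ where
  field
    L U         : ℚ → Set
    L-inhabited : ∃ L
    U-inhabited : ∃ U
    L-lower     : ∀ {p q} → p < q → L q → L p
    U-upper     : ∀ {p q} → p < q → U p → U q
    L-open      : ∀ {q} → L q → ∃ λ r → q < r × L r
    U-open      : ∀ {q} → U q → ∃ λ r → r < q × U r
    disjoint    : ∀ {q} → L q → U q → ⊥
    located     : ∀ {p q} → p < q → L p ⊎ U q

open ℝ
open ℚ-Lemmas

infix 4 _<ᴿ_

_<ᴿ_ : ℝ → ℝ → Set
x <ᴿ y = ∃ λ q → U x q × L y q

fromℚ : ℚ → ℝ
fromℚ p .L q = q < p
fromℚ p .U q = p < q
fromℚ p .L-inhabited = p - 1ℚ , p-1<p p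
fromℚ p .U-inhabited = p + 1ℚ , p<p+r 0<1
fromℚ p .L-lower = <-trans
fromℚ p .U-upper q<r p<q = <-trans p<q q<r
fromℚ p .L-open q<p with <-dense q<p
... | r , q<r , r<p = r , q<r , r<p
fromℚ p .U-open p<q with <-dense p<q
... | r , p<r , r<q = r , r<q , p<r
fromℚ p .disjoint q<p p<q = <-asym q<p p<q
fromℚ p .located {q} {r} q<r with q <? p
... | yes q<p = inj₁ q<p
... | no  q≮p = inj₂ (≤-<-trans (≮⇒≥ q≮p) q<r)

fromℕ : ℕ → ℝ
fromℕ n = fromℚ ((+ n) / 1)

0ᴿ : ℝ
0ᴿ = fromℚ 0ℚ

infix 8 -ᴿ_

-ᴿ_ : ℝ → ℝ
(-ᴿ x) .L q = U x (- q)
(-ᴿ x) .U q = L x (- q)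
(-ᴿ x) .L-inhabited with U-inhabited x
... | q , q∈U = - q , subst (U x) (sym (neg-involutive q)) q∈U
(-ᴿ x) .U-inhabited with L-inhabited x
... | q , q∈L = - q , subst (L x) (sym (neg-involutive q)) q∈L
(-ᴿ x) .L-lower p<q = U-upper x (neg-antimono-< p<q)
(-ᴿ x) .U-upper p<q = L-lower x (neg-antimono-< p<q)
(-ᴿ x) .L-open {q} -q∈U with U-open x -q∈U
... | r , r<-q , r∈U = - r , subst (_< - r) (neg-involutive q) (neg-antimono-< r<-q) , subst (U x) (sym (neg-involutive r)) r∈U
(-ᴿ x) .U-open {q} -q∈L with L-open x -q∈L
... | r , -q<r , r∈L = - r , subst (- r <_) (neg-involutive q) (neg-antimono-< -q<r) , subst (L x) (sym (neg-involutive r)) r∈L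
(-ᴿ x) .disjoint -q∈U -q∈L = disjoint x -q∈L -q∈U
(-ᴿ x) .located p<q with located x (neg-antimono-< p<q)
... | inj₁ -q∈L = inj₂ -q∈L
... | inj₂ -p∈U = inj₁ -p∈U

module ℝ-Lemmas where

  L<U : ∀ x {p q} → L x p → U x q → p < q
  L<U x {p} {q} p∈L q∈U with p <? q
  ... | yes p<q = p<q
  ... | no  p≮q with L-open x p∈L
  ... | r , p<r , r∈L = ⊥-elim (disjoint x (L-lower x (≤-<-trans (≮⇒≥ p≮q) p<r) r∈L) q∈U)

  close : ∀ x {ε} → 0ℚ < ε → ∃ λ a → ∃ λ b → L x a × U x b × b < a + ε
  close x {ε} 0<ε = start (L-inhabited x) (U-inhabited x)
    where
    k : ℕ → ℚ
    k n = (+ n) / 1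
    δ : ℚ
    δ = proj₁ (quot ε (positive⁻¹ (1ℚ + 1ℚ)))
    2δ≡ε : (1ℚ + 1ℚ) * δ ≡ ε
    2δ≡ε = proj₂ (quot ε (positive⁻¹ (1ℚ + 1ℚ)))
    0<δ : 0ℚ < δ
    0<δ = quot-pos (positive⁻¹ (1ℚ + 1ℚ)) 2δ≡ε 0<ε
    cancel : ∀ a b → a + (b - a) ≡ b
    cancel = solve 2 (λ a b → a :+ (b :- a) := b) refl where open +-*-Solver
    double : ∀ a δ → a + δ + δ ≡ a + (1ℚ + 1ℚ) * δ
    double = solve 2 (λ a δ → a :+ δ :+ δ := a :+ (con 1ℚ :+ con 1ℚ) :* δ) refl where open +-*-Solver
    step : ∀ a k δ → a + (1ℚ + k) * δ ≡ a + δ + k * δ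
    step = solve 3 (λ a k δ → a :+ (con 1ℚ :+ k) :* δ := a :+ δ :+ k :* δ) refl where open +-*-Solver
    U-≤ : ∀ {p q} → p ≤ q → U x p → U x q
    U-≤ p≤q p∈U with U-open x p∈U
    ... | r , r<p , r∈U = U-upper x (<-≤-trans r<p p≤q) r∈U
    walk : ∀ n {a} → L x a → U x (a + k n * δ) → ∃ λ a → ∃ λ b → L x a × U x b × b < a + ε
    walk zero    {a} a∈L a∈U =
      ⊥-elim (disjoint x a∈L (subst (U x) (trans (cong (_+_ a) (*-zeroˡ δ)) (+-identityʳ a)) a∈U))
    walk (suc n) {a} a∈L a+∈U with located x (p<p+r {a + δ} 0<δ)
    ... | inj₁ a+δ∈L = walk n a+δ∈L (subst (U x) (trans (cong (λ m → a + m * δ) (fromℕ-suc n)) (step a (k n) δ)) a+∈U)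
    ... | inj₂ a+2δ∈U with U-open x a+2δ∈U
    ... | b , b<a+2δ , b∈U = a , b , a∈L , b∈U , subst (b <_) (trans (double a δ) (cong (_+_ a) 2δ≡ε)) b<a+2δ
    start : ∃ (L x) → ∃ (U x) → ∃ λ a → ∃ λ b → L x a × U x b × b < a + ε
    start (a , a∈L) (b , b∈U) = from (archimedean (b - a) 0<δ)
      where
      from : (∃ λ n → b - a ≤ k n * δ) → ∃ λ a → ∃ λ b → L x a × U x b × b < a + ε
      from (n , b-a≤nδ) = walk n a∈L (U-≤ (subst (_≤ a + k n * δ) (cancel a b) (+-monoʳ-≤ a b-a≤nδ)) b∈U)

open ℝ-Lemmas

infixl 7 _*ᴿ_

-- q < x * y iff some rational box [a , b] × [c , d] around (x , y) has all
-- four corner products above q.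
_*ᴿ_ : ℝ → ℝ → ℝ
(x *ᴿ y) .L q = ∃ λ a → ∃ λ b → ∃ λ c → ∃ λ d →
  (L x a × U x b × L y c × U y d) × (q < a * c × q < a * d × q < b * c × q < b * d)
(x *ᴿ y) .U q = ∃ λ a → ∃ λ b → ∃ λ c → ∃ λ d →
  (L x a × U x b × L y c × U y d) × (a * c < q × a * d < q × b * c < q × b * d < q)
(x *ᴿ y) .L-inhabited with L-inhabited x | U-inhabited x | L-inhabited y | U-inhabited y
... | a , a∈ | b , b∈ | c , c∈ | d , d∈ = _ , a , b , c , d , (a∈ , b∈ , c∈ , d∈) ,
  <min₄⇒ (a * c) (a * d) (b * c) (b * d) (p-1<p _)
(x *ᴿ y) .U-inhabited with L-inhabited x | U-inhabited x | L-inhabited y | U-inhabited y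
... | a , a∈ | b , b∈ | c , c∈ | d , d∈ = _ , a , b , c , d , (a∈ , b∈ , c∈ , d∈) ,
  max₄<⇒ (a * c) (a * d) (b * c) (b * d) (p<p+r 0<1)
(x *ᴿ y) .L-lower p<q (a , b , c , d , abcd∈ , (q<₁ , q<₂ , q<₃ , q<₄)) =
  a , b , c , d , abcd∈ , (<-trans p<q q<₁ , <-trans p<q q<₂ , <-trans p<q q<₃ , <-trans p<q q<₄)
(x *ᴿ y) .U-upper p<q (a , b , c , d , abcd∈ , (<p₁ , <p₂ , <p₃ , <p₄)) =
  a , b , c , d , abcd∈ , (<-trans <p₁ p<q , <-trans <p₂ p<q , <-trans <p₃ p<q , <-trans <p₄ p<q)
(x *ᴿ y) .L-open (a , b , c , d , abcd∈ , q<) with <-dense (<-min₄ (a * c) (a * d) (b * c) (b * d) q<)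
... | r , q<r , r<m = r , q<r , a , b , c , d , abcd∈ , <min₄⇒ (a * c) (a * d) (b * c) (b * d) r<m
(x *ᴿ y) .U-open (a , b , c , d , abcd∈ , <q) with <-dense (max₄-< (a * c) (a * d) (b * c) (b * d) <q)
... | r , m<r , r<q = r , r<q , a , b , c , d , abcd∈ , max₄<⇒ (a * c) (a * d) (b * c) (b * d) m<r
(x *ᴿ y) .disjoint {q}
  (a , b , c , d , (a∈ , b∈ , c∈ , d∈) , q<) (a′ , b′ , c′ , d′ , (a′∈ , b′∈ , c′∈ , d′∈) , <q) =
  <-asym
    (corners-< (p≤p⊔q a a′) (⊔-≤ x a∈ a′∈ b∈) (p≤p⊔q c c′) (⊔-≤ y c∈ c′∈ d∈) q<)
    (corners-> (p≤q⊔p a a′) (⊔-≤ x a∈ a′∈ b′∈) (p≤q⊔p c c′) (⊔-≤ y c∈ c′∈ d′∈) <q)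
  where
  ⊔-≤ : ∀ z {s t u} → L z s → L z t → U z u → s ⊔ t ≤ u
  ⊔-≤ z {u = u} s∈ t∈ u∈ = ⊔-elim (_≤ u) (<⇒≤ (L<U z s∈ u∈)) (<⇒≤ (L<U z t∈ u∈))
(x *ᴿ y) .located {p} {q} p<q
  with L-inhabited x | U-inhabited x | L-inhabited y | U-inhabited y
... | a₀ , a₀∈ | b₀ , b₀∈ | c₀ , c₀∈ | d₀ , d₀∈ = split
  where
  m : ℚ
  m = max₄ (∣ a₀ ∣) (∣ b₀ ∣) (∣ c₀ ∣) (∣ d₀ ∣) + 1ℚ
  ≤m : ∀ {t} → t ≤ max₄ (∣ a₀ ∣) (∣ b₀ ∣) (∣ c₀ ∣) (∣ d₀ ∣) → t ≤ m
  ≤m t≤ = ≤-trans t≤ (<⇒≤ (p<p+r 0<1))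
  bounds : ∣ a₀ ∣ ≤ _ × ∣ b₀ ∣ ≤ _ × ∣ c₀ ∣ ≤ _ × ∣ d₀ ∣ ≤ _
  bounds = max₄-≥ (∣ a₀ ∣) (∣ b₀ ∣) (∣ c₀ ∣) (∣ d₀ ∣)
  0<m : 0ℚ < m
  0<m = ≤-<-trans (≤-trans (0≤∣p∣ a₀) (proj₁ bounds)) (p<p+r 0<1)
  p≤∣p∣ : ∀ p → p ≤ ∣ p ∣
  p≤∣p∣ p with ≤-total 0ℚ p
  ... | inj₁ 0≤p = ≤-reflexive (sym (0≤p⇒∣p∣≡p 0≤p))
  ... | inj₂ p≤0 = ≤-trans p≤0 (0≤∣p∣ p)
  -m≤ : ∀ {t} → ∣ t ∣ ≤ max₄ (∣ a₀ ∣) (∣ b₀ ∣) (∣ c₀ ∣) (∣ d₀ ∣) → - m ≤ t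
  -m≤ {t} ∣t∣≤ = subst (- m ≤_) (neg-involutive t)
    (neg-antimono-≤ (≤-trans (p≤∣p∣ (- t)) (≤-trans (≤-reflexive (∣-p∣≡∣p∣ t)) (≤m ∣t∣≤))))
  4m : ℚ
  4m = (m + m) + (m + m)
  0<4m : 0ℚ < 4m
  0<4m = +-pos (+-pos 0<m 0<m) (+-pos 0<m 0<m)
  ε : ℚ
  ε = proj₁ (quot (q - p) 0<4m)
  4mε≡q-p : 4m * ε ≡ q - p
  4mε≡q-p = proj₂ (quot (q - p) 0<4m)
  0<ε : 0ℚ < ε
  0<ε = quot-pos 0<4m 4mε≡q-p (p<q⇒0<q-p p<q)

  Refinement : ℝ → Set
  Refinement z = ∃ λ s → ∃ λ t → L z s × U z t × - m ≤ s × s ≤ m × - m ≤ t × t ≤ m × 0ℚ < t - s × t - s < ε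

  refine : ∀ z {s t} → L z s → U z t → - m ≤ s → t ≤ m →
           Refinement z
  refine z {s₀} {t₀} s₀∈ t₀∈ -m≤s₀ t₀≤m = from (close z 0<ε)
   where
   from : (∃ λ a → ∃ λ b → L z a × U z b × b < a + ε) →
          Refinement z
   from (s₁ , t₁ , s₁∈ , t₁∈ , t₁<s₁+ε) =
    s , t , s∈ , t∈ , -m≤s , ≤-trans (<⇒≤ s<t) t≤m , ≤-trans -m≤s (<⇒≤ s<t) , t≤m , p<q⇒0<q-p s<t ,
    subst (t - s <_) (cancel s ε) (+-monoˡ-< (- s) t<s+ε)
    where
    s t : ℚ
    s = s₀ ⊔ s₁
    t = t₀ ⊓ t₁
    s∈ : L z s
    s∈ = ⊔-elim (L z) s₀∈ s₁∈
    t∈ : U z t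
    t∈ = ⊓-elim (U z) t₀∈ t₁∈
    -m≤s : - m ≤ s
    -m≤s = ≤-trans -m≤s₀ (p≤p⊔q s₀ s₁)
    t≤m : t ≤ m
    t≤m = ≤-trans (p⊓q≤p t₀ t₁) t₀≤m
    s<t : s < t
    s<t = L<U z s∈ t∈
    t<s+ε : t < s + ε
    t<s+ε = ≤-<-trans (p⊓q≤q t₀ t₁) (<-≤-trans t₁<s₁+ε (+-monoˡ-≤ ε (p≤q⊔p s₀ s₁)))
    cancel : ∀ s ε → s + ε - s ≡ ε
    cancel = solve 2 (λ s ε → s :+ ε :- s := ε) refl where open +-*-Solver

  split : L (x *ᴿ y) p ⊎ U (x *ᴿ y) q
  split = from
    (refine x a₀∈ b₀∈ (-m≤ (proj₁ bounds)) (≤m (≤-trans (p≤∣p∣ b₀) (proj₁ (proj₂ bounds)))))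
    (refine y c₀∈ d₀∈ (-m≤ (proj₁ (proj₂ (proj₂ bounds)))) (≤m (≤-trans (p≤∣p∣ d₀) (proj₂ (proj₂ (proj₂ bounds))))))
   where
   from : Refinement x → Refinement y → L (x *ᴿ y) p ⊎ U (x *ᴿ y) q
   from (a , b , a∈ , b∈ , -m≤a , a≤m , -m≤b , b≤m , 0<b-a , b-a<ε)
        (c , d , c∈ , d∈ , -m≤c , c≤m , -m≤d , d≤m , 0<d-c , d-c<ε) = decide (p ≤? w - (δ + δ))
    where
    δ w : ℚ
    δ = m * ε
    w = a * c
    0<δ : 0ℚ < δ
    0<δ = *-pos 0<m 0<ε
    -δ<0 : - δ < 0ℚ
    -δ<0 = neg-antimono-< 0<δ

    Near : ℚ → Set
    Near z = w - (δ + δ) < z × z < w + (δ + δ)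
    near : ∀ u v {z} → w + (u + v) ≡ z → - δ < u × u < δ → - δ < v × v < δ → Near z
    near u v w+u+v≡z (-δ<u , u<δ) (-δ<v , v<δ) =
      subst₂ _<_ (cong (_+_ w) (sym (neg-distrib-+ δ δ))) w+u+v≡z (+-monoʳ-< w (+-mono-< -δ<u -δ<v)) ,
      subst (_< w + (δ + δ)) w+u+v≡z (+-monoʳ-< w (+-mono-< u<δ v<δ))
    near-0 : - δ < 0ℚ × 0ℚ < δ
    near-0 = -δ<0 , 0<δ
    near-ac : Near (a * c)
    near-ac = near 0ℚ 0ℚ (trans (cong (_+_ w) (+-identityʳ 0ℚ)) (+-identityʳ w)) near-0 near-0
    near-ad : Near (a * d)
    near-ad = near (a * (d - c)) 0ℚ (eq a c d) (bounded-* -m≤a a≤m 0<m 0<d-c d-c<ε) near-0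
      where
      eq : ∀ a c d → a * c + (a * (d - c) + 0ℚ) ≡ a * d
      eq = solve 3 (λ a c d → a :* c :+ (a :* (d :- c) :+ con 0ℚ) := a :* d) refl where open +-*-Solver
    near-bc : Near (b * c)
    near-bc = near (c * (b - a)) 0ℚ (eq a b c) (bounded-* -m≤c c≤m 0<m 0<b-a b-a<ε) near-0
      where
      eq : ∀ a b c → a * c + (c * (b - a) + 0ℚ) ≡ b * c
      eq = solve 3 (λ a b c → a :* c :+ (c :* (b :- a) :+ con 0ℚ) := b :* c) refl where open +-*-Solver
    near-bd : Near (b * d)
    near-bd = near (c * (b - a)) (b * (d - c)) (eq a b c d)
      (bounded-* -m≤c c≤m 0<m 0<b-a b-a<ε) (bounded-* -m≤b b≤m 0<m 0<d-c d-c<ε)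
      where
      eq : ∀ a b c d → a * c + (c * (b - a) + b * (d - c)) ≡ b * d
      eq = solve 4 (λ a b c d → a :* c :+ (c :* (b :- a) :+ b :* (d :- c)) := b :* d) refl where open +-*-Solver

    decide : Dec (p ≤ w - (δ + δ)) → L (x *ᴿ y) p ⊎ U (x *ᴿ y) q
    decide (yes p≤) = inj₁ (a , b , c , d , (a∈ , b∈ , c∈ , d∈) ,
      (≤-<-trans p≤ (proj₁ near-ac) , ≤-<-trans p≤ (proj₁ near-ad) ,
       ≤-<-trans p≤ (proj₁ near-bc) , ≤-<-trans p≤ (proj₁ near-bd)))
    decide (no p≰) = inj₂ (a , b , c , d , (a∈ , b∈ , c∈ , d∈) ,
      (<-trans (proj₂ near-ac) w+2δ<q , <-trans (proj₂ near-ad) w+2δ<q ,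
       <-trans (proj₂ near-bc) w+2δ<q , <-trans (proj₂ near-bd) w+2δ<q))
      where
      w+2δ<q : w + (δ + δ) < q
      w+2δ<q = threshold p q w m ε 4mε≡q-p (≰⇒> {p} {w - (δ + δ)} p≰)

infixr 8 _^ᴿ_

-- Real power of a positive integer b.  Since b ≥ 1, b ^ y is the supremum of
-- the b ^ (s / t) over rationals s / t < y and the infimum over s / t > y;
-- for q > 0, q < b ^ (s / t) means q ^ t < b ^ s.
_^ᴿ_ : (b : ℕ) .{{_ : ℕ.NonZero b}} → ℝ → ℝ
(b ^ᴿ y) = record
  { L = λ q → ∃ λ r → L y r × (q ≤ 0ℚ ⊎ q ^ ↧ₙ r < x ^ℤ ↥ r)
  ; U = λ q → ∃ λ r → U y r × 0ℚ < q × x ^ℤ ↥ r < q ^ ↧ₙ r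
  ; L-inhabited = 0ℚ , proj₁ (L-inhabited y) , proj₂ (L-inhabited y) , inj₁ ≤-refl
  ; U-inhabited = U-inh (U-inhabited y)
  ; L-lower = L-low
  ; U-upper = λ { p<q (r , r∈U , 0<p , <pᵗ) →
      r , r∈U , <-trans 0<p p<q , <-trans <pᵗ (^-mono-< (ℚ.ℚ.denominator-1 r) (<⇒≤ 0<p) p<q) }
  ; L-open = L-op
  ; U-open = U-op
  ; disjoint = disj
  ; located = loc
  }
  where
  x : ℚ
  x = (+ b) / 1
  instance
    x≢0 : NonZero x
    x≢0 = pos⇒nonZero x {{normalize-pos b 1}}
  1≤x : 1ℚ ≤ x
  1≤x = toℚᵘ-cancel-≤ (ℚᵘₚ.≤-respʳ-≃ (ℚᵘₚ.≃-sym (toℚᵘ-fromℚᵘ (ℚᵘ.mkℚᵘ (+ b) 0)))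
    (ℚᵘ.*≤* (ℤₚ.*-monoʳ-≤-nonNeg (+ 1) (ℤ.+≤+ (ℕ.>-nonZero⁻¹ b)))))
  open ℤ-Power-Lemmas {x} 1≤x

  below above : ℚ → ℚ → Set
  below q r = q ^ ↧ₙ r < x ^ℤ ↥ r
  above q r = x ^ℤ ↥ r < q ^ ↧ₙ r

  U-inh : ∃ (U y) → ∃ λ q → ∃ λ r → U y r × 0ℚ < q × above q r
  U-inh (r , r∈U) = 1ℚ + x ^ℤ ↥ r , r , r∈U , <-trans 0<1 1<q ,
    <-≤-trans (subst (x ^ℤ ↥ r <_) (+-comm (x ^ℤ ↥ r) 1ℚ) (p<p+r 0<1)) (p≤p^ (ℚ.ℚ.denominator-1 r) (<⇒≤ 1<q))
    where
    1<q : 1ℚ < 1ℚ + x ^ℤ ↥ r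
    1<q = p<p+r (^ℤ-pos (↥ r))

  L-low : ∀ {p q} → p < q → (∃ λ r → L y r × (q ≤ 0ℚ ⊎ below q r)) → ∃ λ r → L y r × (p ≤ 0ℚ ⊎ below p r)
  L-low p<q (r , r∈L , inj₁ q≤0) = r , r∈L , inj₁ (<⇒≤ (<-≤-trans p<q q≤0))
  L-low {p} p<q (r , r∈L , inj₂ qᵗ<) with p ≤? 0ℚ
  ... | yes p≤0 = r , r∈L , inj₁ p≤0
  ... | no  p≰0 = r , r∈L , inj₂ (<-trans (^-mono-< (ℚ.ℚ.denominator-1 r) (<⇒≤ (≰⇒> p≰0)) p<q) qᵗ<)

  L-op : ∀ {q} → (∃ λ r → L y r × (q ≤ 0ℚ ⊎ below q r)) →
         ∃ λ q′ → q < q′ × ∃ λ r → L y r × (q′ ≤ 0ℚ ⊎ below q′ r)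
  L-op {q} (r , r∈L , q≤0⊎) = by (q ≤? 0ℚ) q≤0⊎
    where
    Goal : Set
    Goal = ∃ λ q′ → q < q′ × ∃ λ r → L y r × (q′ ≤ 0ℚ ⊎ below q′ r)
    nonpositive-case : q ≤ 0ℚ → (∃ λ q′ → 0ℚ < q′ × q′ < 1ℚ ⊓ x ^ℤ ↥ r) → Goal
    nonpositive-case q≤0 (q′ , 0<q′ , q′<m) = q′ , ≤-<-trans q≤0 0<q′ , r , r∈L ,
      inj₂ (≤-<-trans (p^≤p (ℚ.ℚ.denominator-1 r) (<⇒≤ 0<q′) (<⇒≤ (<-≤-trans q′<m (p⊓q≤p 1ℚ (x ^ℤ ↥ r)))))
        (<-≤-trans q′<m (p⊓q≤q 1ℚ (x ^ℤ ↥ r))))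
    positive-case : (∃ λ q′ → q < q′ × below q′ r) → Goal
    positive-case (q′ , q<q′ , q′ᵗ<) = q′ , q<q′ , r , r∈L , inj₂ q′ᵗ<
    by : Dec (q ≤ 0ℚ) → q ≤ 0ℚ ⊎ below q r → Goal
    by (yes q≤0) _          = nonpositive-case q≤0 (<-dense (⊓-elim (0ℚ <_) 0<1 (^ℤ-pos (↥ r))))
    by (no q≰0)  (inj₁ q≤0) = ⊥-elim (q≰0 q≤0)
    by (no q≰0)  (inj₂ qᵗ<) = positive-case (^-open-< (↧ₙ r) (≰⇒> q≰0) qᵗ<)

  U-op : ∀ {q} → (∃ λ r → U y r × 0ℚ < q × above q r) →
         ∃ λ q′ → q′ < q × ∃ λ r → U y r × 0ℚ < q′ × above q′ r
  U-op {q} (r , r∈U , 0<q , <qᵗ) = from (^-open-> (↧ₙ r) 0<q (^ℤ-pos (↥ r)) <qᵗ)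
    where
    from : (∃ λ q′ → 0ℚ < q′ × q′ < q × above q′ r) →
           ∃ λ q′ → q′ < q × ∃ λ r → U y r × 0ℚ < q′ × above q′ r
    from (q′ , 0<q′ , q′<q , <q′ᵗ) = q′ , q′<q , r , r∈U , 0<q′ , <q′ᵗ

  disj : ∀ {q} → (∃ λ r → L y r × (q ≤ 0ℚ ⊎ below q r)) → (∃ λ r → U y r × 0ℚ < q × above q r) → ⊥
  disj (r , r∈L , inj₁ q≤0) (r′ , r′∈U , 0<q , _) = <-irrefl refl (<-≤-trans 0<q q≤0)
  disj {q} (r , r∈L , inj₂ qᵗ<) (r′ , r′∈U , 0<q , <qᵗ′) = <-irrefl refl (begin-strict
    (q ^ t) ^ t′                  <⟨ ^-mono-< (ℚ.ℚ.denominator-1 r′) (<⇒≤ (^-pos t 0<q)) qᵗ< ⟩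
    (x ^ℤ ↥ r) ^ t′               ≡⟨ ^ℤ-assoc (↥ r) t′ ⟩
    x ^ℤ (↥ r ℤ.* + t′)           ≤⟨ ^ℤ-mono-≤ (ℤₚ.<⇒≤ (drop-*<* (L<U y r∈L r′∈U))) ⟩
    x ^ℤ (↥ r′ ℤ.* + t)           ≡⟨ ^ℤ-assoc (↥ r′) t ⟨
    (x ^ℤ ↥ r′) ^ t               <⟨ ^-mono-< (ℚ.ℚ.denominator-1 r) (<⇒≤ (^ℤ-pos (↥ r′))) <qᵗ′ ⟩
    (q ^ t′) ^ t                  ≡⟨ ^-assocʳ q t′ t ⟩
    q ^ (t′ ℕ.* t)                ≡⟨ cong (q ^_) (ℕₚ.*-comm t′ t) ⟩
    q ^ (t ℕ.* t′)                ≡⟨ ^-assocʳ q t t′ ⟨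
    (q ^ t) ^ t′                  ∎)
    where
    open ≤-Reasoning
    t = ↧ₙ r
    t′ = ↧ₙ r′

  above-step : ∀ {p q n r r′} → 0ℚ < p → p < q → p ^ suc n * x < q ^ suc n →
               r′ < r + (+ 1) / suc n → x ^ℤ ↥ r ≤ p ^ ↧ₙ r → above q r′
  above-step {p} {q} {n} {r} {r′} 0<p p<q pᵀx<qᵀ r′<r+1/T x^r≤p = ^-cancel-< (t ℕ.* T) (<⇒≤ (^-pos t′ 0<q)) (begin-strict
    (x ^ℤ ↥ r′) ^ (t ℕ.* T)                    ≡⟨ ^ℤ-assoc (↥ r′) (t ℕ.* T) ⟩
    x ^ℤ (↥ r′ ℤ.* + (t ℕ.* T))                ≤⟨ ^ℤ-mono-≤ (ℤₚ.<⇒≤ exponents) ⟩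
    x ^ℤ ((↥ r ℤ.* + T ℤ.+ + 1 ℤ.* + t) ℤ.* + t′) ≡⟨ ^ℤ-assoc (↥ r ℤ.* + T ℤ.+ + 1 ℤ.* + t) t′ ⟨
    (x ^ℤ (↥ r ℤ.* + T ℤ.+ + 1 ℤ.* + t)) ^ t′  ≡⟨ cong (_^ t′) (^ℤ-homo-+ (↥ r ℤ.* + T) (+ 1 ℤ.* + t)) ⟩
    (x ^ℤ (↥ r ℤ.* + T) * x ^ℤ (+ 1 ℤ.* + t)) ^ t′ ≡⟨ cong (_^ t′) (cong₂ _*_ (sym (^ℤ-assoc (↥ r) T)) (cong (x ^ℤ_) (ℤₚ.*-identityˡ (+ t)))) ⟩
    ((x ^ℤ ↥ r) ^ T * x ^ t) ^ t′              ≤⟨ ^-mono-≤ t′ 0≤lhs (*-monoˡ-≤ (<⇒≤ (^-pos t 0<x)) (^-mono-≤ T (<⇒≤ (^ℤ-pos (↥ r))) x^r≤p)) ⟩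
    ((p ^ t) ^ T * x ^ t) ^ t′                 ≡⟨ cong (λ z → (z * x ^ t) ^ t′) (swap p t T) ⟩
    ((p ^ T) ^ t * x ^ t) ^ t′                 ≡⟨ cong (_^ t′) (^-distrib-* (p ^ T) x t) ⟨
    ((p ^ T * x) ^ t) ^ t′                     <⟨ ^-mono-< (ℚ.ℚ.denominator-1 r′) (<⇒≤ (^-pos t 0<pᵀx)) (^-mono-< (ℚ.ℚ.denominator-1 r) (<⇒≤ 0<pᵀx) pᵀx<qᵀ) ⟩
    ((q ^ T) ^ t) ^ t′                         ≡⟨ cong (_^ t′) (trans (swap q T t) (^-assocʳ q t T)) ⟩
    (q ^ (t ℕ.* T)) ^ t′                       ≡⟨ swap q (t ℕ.* T) t′ ⟩
    (q ^ t′) ^ (t ℕ.* T)                       ∎)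
    where
    open ≤-Reasoning
    t t′ T : ℕ
    t = ↧ₙ r
    t′ = ↧ₙ r′
    T = suc n
    0<q : 0ℚ < q
    0<q = <-trans 0<p p<q
    0<pᵀx : 0ℚ < p ^ T * x
    0<pᵀx = *-pos (^-pos T 0<p) 0<x
    0≤lhs : 0ℚ ≤ (x ^ℤ ↥ r) ^ T * x ^ t
    0≤lhs = <⇒≤ (*-pos (^-pos T (^ℤ-pos (↥ r))) (^-pos t 0<x))
    swap : ∀ z m n → (z ^ m) ^ n ≡ (z ^ n) ^ m
    swap z m n = trans (^-assocʳ z m n) (trans (cong (z ^_) (ℕₚ.*-comm m n)) (sym (^-assocʳ z n m)))
    exponents : ↥ r′ ℤ.* + (t ℕ.* T) ℤ.< (↥ r ℤ.* + T ℤ.+ + 1 ℤ.* + t) ℤ.* + t′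
    exponents = numerators-< r r′ n r′<r+1/T

  loc : ∀ {p q} → p < q →
        (∃ λ r → L y r × (p ≤ 0ℚ ⊎ below p r)) ⊎ (∃ λ r → U y r × 0ℚ < q × above q r)
  loc {p} {q} p<q = by (p ≤? 0ℚ)
    where
    Goal : Set
    Goal = (∃ λ r → L y r × (p ≤ 0ℚ ⊎ below p r)) ⊎ (∃ λ r → U y r × 0ℚ < q × above q r)
    decide : 0ℚ < p → ∀ {n r r′} → p ^ suc n * x < q ^ suc n → L y r → U y r′ →
             r′ < r + (+ 1) / suc n → Dec (below p r) → Goal
    decide 0<p pᵀx<qᵀ r∈L r′∈U r′<r+1/T (yes pᵗ<) = inj₁ (_ , r∈L , inj₂ pᵗ<)
    decide 0<p {n} {r} {r′} pᵀx<qᵀ r∈L r′∈U r′<r+1/T (no pᵗ≮) =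
      inj₂ (_ , r′∈U , <-trans 0<p p<q , above-step {p} {q} {n} {r} {r′} 0<p p<q pᵀx<qᵀ r′<r+1/T (≮⇒≥ pᵗ≮))
    approximate : 0ℚ < p → (∃ λ n → p ^ suc n * x < q ^ suc n) → Goal
    approximate 0<p (n , pᵀx<qᵀ) = from (close y (positive⁻¹ ((+ 1) / suc n) {{normalize-pos 1 (suc n)}}))
      where
      from : (∃ λ r → ∃ λ r′ → L y r × U y r′ × r′ < r + (+ 1) / suc n) → Goal
      from (r , r′ , r∈L , r′∈U , r′<r+1/T) =
        decide 0<p {n} {r} {r′} pᵀx<qᵀ r∈L r′∈U r′<r+1/T (p ^ ↧ₙ r <? x ^ℤ ↥ r)
    by : Dec (p ≤ 0ℚ) → Goal
    by (yes p≤0) = inj₁ (proj₁ (L-inhabited y) , proj₂ (L-inhabited y) , inj₁ p≤0)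
    by (no p≰0)  = approximate (≰⇒> p≰0) (^-outgrows x (≰⇒> p≰0) p<q)

{-# OPTIONS --safe #-}
module Submission where

-- Every k satisfies k ≤ R(k)·b² for some square b² ∣ k.  Since Σ log b / b² converges, the b's
-- for k ≤ n multiply to at most Cⁿ, while the φ(n) totatives multiply to at least
-- φ(n)! ≥ (φ(n)/3)^φ(n).  Euler's product gives n ≤ (1+ω(n)) φ(n), so the geometric mean
-- of the R(nᵢ) is at least n / E^(1+ω(n)) for an absolute constant E.  Finally
-- E^ω(n) ≪ R(n)^θ, because every prime above E^(1/θ) contributes more than E to R(n)^θ.

open import Data.Integer using (+_)
open import Data.List.Base using (map)
open import Data.Nat using (_≤_)
open import Data.Nat.ListAction using (product)
open import Data.Product using (Σ-syntax; _×_)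
open import Data.Rational using (_/_)
open import Defs

open import Algebra.Bundles using (CommutativeRing)
open import Data.Empty using (⊥-elim)
open import Data.Integer as ℤ using (ℤ; -[1+_])
import Data.Integer.Properties as ℤₚ
open import Data.List.Base using (List; []; _∷_; _++_; _∷ʳ_; length; filter; applyUpTo)
open import Data.List.Membership.Propositional using (_∈_)
open import Data.List.Membership.Propositional.Properties using (∈-filter⁺; ∈-applyUpTo⁺)
open import Data.List.Properties
  using (filter-++; filter-accept; filter-reject; length-filter; length-applyUpTo; length-++; applyUpTo-∷ʳ; map-++; ++-identityʳ)
open import Data.List.Relation.Unary.All as All using (All; []; _∷_; all?)
import Data.List.Relation.Unary.All.Properties as All
open import Data.List.Relation.Unary.AllPairs using (AllPairs; []; _∷_)
import Data.List.Relation.Unary.AllPairs.Properties as AllPairs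
open import Data.Nat as ℕ hiding (_/_)
open import Data.Nat.Coprimality using (Coprime; coprime?; 1-coprimeTo)
open import Data.Nat.Divisibility
open import Data.Nat.DivMod
  using (m/n*n≤m; m*n/n≡m; m≡m%n+[m/n]*n; m%n<n; /-monoʳ-≤; /-congʳ; m/n/o≡m/[n*o]; n/1≡n)
open import Data.Nat.Induction using (<-rec)
open import Data.Nat.ListAction using (sum)
open import Data.Nat.ListAction.Properties using (product-++; sum-++; ∈⇒∣product)
open import Data.Nat.Logarithm
open import Data.Nat.Primality
open import Data.Nat.Primality.Factorisation using (factorise)
open import Data.Nat.Properties
open import Data.Nat.Tactic.RingSolver using (solve-∀)
open import Data.Product using (∃; _,_; proj₁; proj₂)
open import Data.Rational as ℚ using (ℚ; mkℚ; 0ℚ; 1ℚ; ↥_; ↧ₙ_)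
  renaming (_+_ to _+ℚ_; _*_ to _*ℚ_; _<_ to _<ℚ_; _≤_ to _≤ℚ_)
import Data.Rational.Properties as ℚₚ
open import Data.Rational.Solver using (module +-*-Solver)
import Data.Rational.Unnormalised as ℚᵘ
import Data.Rational.Unnormalised.Properties as ℚᵘₚ
open import Data.Sum using (inj₁; inj₂; [_,_]′)
open import Function using (_∘_; id; it)
open import Level using (0ℓ)
open import Relation.Binary.PropositionalEquality hiding ([_])
open import Relation.Nullary
open import Relation.Nullary.Decidable using (_×-dec_)
open import Relation.Unary using (Pred; Decidable)
open import Algebra.Properties.CommutativeSemiring.Exp
  (CommutativeRing.commutativeSemiring ℚₚ.+-*-commutativeRing)
  using (^-assocʳ; ^-distrib-*) renaming (_^_ to _^ℚ_)

open ℚ-Lemmas using (*-pos; quot; quot-pos; ^-pos)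

-- Sums over 1, …, n

-- Summing over all `k < n` instead of over the totatives leaves a factor `C ^ n`, and the `φ n`-th
-- root turns it into `C ^ (n / φ n)`. This is why `n / φ n` must be bounded linearly in `ω n`: an
-- exponent linear in `ω n` is exactly what a power of `R n` can absorb, so the crude bound
-- `1 + ω n` is good enough. Real exponents exist only as Dedekind cuts, so everything before the
-- last part is an inequality between natural numbers: `w` stands in for the logarithm, Euler's
-- product is cross-multiplied, and roots are cleared by raising to the power `φ n`. The real `θ` is
-- traded for a unit fraction `1/t` below it, which makes `R(n)^(-1/t)` a matter of `t`-th powers.
-- The geometric mean is replaced by its integer floor `s`; as `s ≥ 1`, this costs only a factor 2.

∑ : ℕ → (ℕ → ℕ) → ℕ
∑ zero    f = 0
∑ (suc n) f = ∑ n f + f (suc n)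

∑-cong : ∀ n {f g} → (∀ k → f k ≡ g k) → ∑ n f ≡ ∑ n g
∑-cong zero    f≗g = refl
∑-cong (suc n) f≗g = cong₂ _+_ (∑-cong n f≗g) (f≗g (suc n))

∑-mono-≤ : ∀ n {f g} → (∀ k → 1 ≤ k → f k ≤ g k) → ∑ n f ≤ ∑ n g
∑-mono-≤ zero    f≤g = z≤n
∑-mono-≤ (suc n) f≤g = +-mono-≤ (∑-mono-≤ n f≤g) (f≤g (suc n) (s≤s z≤n))

∑-+ : ∀ n f g → ∑ n (λ k → f k + g k) ≡ ∑ n f + ∑ n g
∑-+ zero    f g = refl
∑-+ (suc n) f g = trans (cong (_+ (f (suc n) + g (suc n))) (∑-+ n f g))
  (interchange (∑ n f) (∑ n g) (f (suc n)) (g (suc n)))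
  where
  interchange : ∀ a b c d → a + b + (c + d) ≡ a + c + (b + d)
  interchange = solve-∀

∑-*ˡ : ∀ n c f → ∑ n (λ k → c * f k) ≡ c * ∑ n f
∑-*ˡ zero    c f = sym (*-zeroʳ c)
∑-*ˡ (suc n) c f = trans (cong (_+ c * f (suc n)) (∑-*ˡ n c f)) (sym (*-distribˡ-+ c (∑ n f) (f (suc n))))

∑-swap : ∀ m n (f : ℕ → ℕ → ℕ) → ∑ m (λ i → ∑ n (f i)) ≡ ∑ n (λ j → ∑ m (λ i → f i j))
∑-swap zero    n f = sym (∑-0 n)
  where
  ∑-0 : ∀ n → ∑ n (λ _ → 0) ≡ 0
  ∑-0 zero    = refl
  ∑-0 (suc n) = trans (+-identityʳ _) (∑-0 n)
∑-swap (suc m) n f = trans (cong (_+ ∑ n (f (suc m))) (∑-swap m n f)) (sym (∑-+ n (λ j → ∑ m (λ i → f i j)) (f (suc m))))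

∑-1 : ∀ n → ∑ n (λ _ → 1) ≡ n
∑-1 zero    = refl
∑-1 (suc n) = trans (+-comm (∑ n (λ _ → 1)) 1) (cong suc (∑-1 n))

term≤∑ : ∀ {n k} f → 1 ≤ k → k ≤ n → f k ≤ ∑ n f
term≤∑ {zero}  f 1≤k z≤n = contradiction 1≤k (λ ())
term≤∑ {suc n} {k} f 1≤k k≤1+n with m≤n⇒m<n∨m≡n k≤1+n
... | inj₁ (s≤s k≤n) = ≤-trans (term≤∑ f 1≤k k≤n) (m≤m+n (∑ n f) (f (suc n)))
... | inj₂ refl      = m≤n+m (f (suc n)) (∑ n f)

∑-pairs : ∀ n f → ∑ (suc (n + n)) f ≡ f 1 + ∑ n (λ c → f (c + c) + f (suc (c + c)))
∑-pairs zero    f = +-comm 0 (f 1)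
∑-pairs (suc n) f rewrite +-suc n n =
  trans (cong (λ s → s + f (2 + (n + n)) + f (3 + (n + n))) (∑-pairs n f)) (assoc (f 1) _ _ _)
  where
  assoc : ∀ a b c d → a + b + c + d ≡ a + (b + (c + d))
  assoc = solve-∀

-- Indicators and sums over multiples

𝟙 : ∀ {p} {P : Set p} → Dec P → ℕ
𝟙 (yes _) = 1
𝟙 (no  _) = 0

𝟙-cong : ∀ {p q} {P : Set p} {Q : Set q} (P? : Dec P) (Q? : Dec Q) → (P → Q) → (Q → P) → 𝟙 P? ≡ 𝟙 Q?
𝟙-cong (yes p) (yes q) f g = refl
𝟙-cong (no ¬p) (no ¬q) f g = refl
𝟙-cong (yes p) (no ¬q) f g = contradiction (f p) ¬q
𝟙-cong (no ¬p) (yes q) f g = contradiction (g q) ¬p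

𝟙-true : ∀ {p} {P : Set p} (P? : Dec P) → P → 𝟙 P? ≡ 1
𝟙-true (yes _) p = refl
𝟙-true (no ¬p) p = contradiction p ¬p

𝟙-false : ∀ {p} {P : Set p} (P? : Dec P) → ¬ P → 𝟙 P? ≡ 0
𝟙-false (yes p) ¬p = contradiction p ¬p
𝟙-false (no _)  ¬p = refl

-- Writing the length as `r + q * d` lets the recursion drop one index at a time: the top index is a
-- multiple of `d` exactly when `r = 0`, and then `r` restarts at `d - 1`.
∑-multiples-+ : ∀ d .{{_ : NonZero d}} q r (g : ℕ → ℕ) → r < d →
  ∑ (r + q * d) (λ k → 𝟙 (d ∣? k) * g k) ≡ ∑ q (λ j → g (j * d))
∑-multiples-+ d zero    zero    g r<d = refl
∑-multiples-+ d@(suc d-1) (suc q) zero    g r<d = begin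
  ∑ (d-1 + q * d) h + h (d + q * d)        ≡⟨ cong₂ _+_ (∑-multiples-+ d q d-1 g ≤-refl)
                                                 (cong (_* g (d + q * d)) (𝟙-true (d ∣? (d + q * d)) (n∣m*n (suc q)))) ⟩
  ∑ q (λ j → g (j * d)) + 1 * g (d + q * d) ≡⟨ cong (_+_ (∑ q (λ j → g (j * d)))) (*-identityˡ _) ⟩
  ∑ q (λ j → g (j * d)) + g (d + q * d)     ∎
  where
  open ≡-Reasoning
  h = λ k → 𝟙 (d ∣? k) * g k
∑-multiples-+ d q (suc r) g 1+r<d = begin
  ∑ (r + q * d) h + h (suc r + q * d)  ≡⟨ cong₂ _+_ (∑-multiples-+ d q r g (<-trans ≤-refl 1+r<d))
                                            (cong (_* g (suc r + q * d)) (𝟙-false (d ∣? (suc r + q * d)) d∤)) ⟩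
  ∑ q (λ j → g (j * d)) + 0            ≡⟨ +-identityʳ _ ⟩
  ∑ q (λ j → g (j * d))                ∎
  where
  open ≡-Reasoning
  h = λ k → 𝟙 (d ∣? k) * g k
  d∤ : d ∤ suc r + q * d
  d∤ d∣ = >⇒∤ 1+r<d (∣m+n∣m⇒∣n (subst (d ∣_) (+-comm (suc r) (q * d)) d∣) (n∣m*n q))

∑-multiples : ∀ d .{{_ : NonZero d}} n (g : ℕ → ℕ) →
  ∑ n (λ k → 𝟙 (d ∣? k) * g k) ≡ ∑ (n ℕ./ d) (λ j → g (j * d))
∑-multiples d n g = trans
  (cong (λ m → ∑ m (λ k → 𝟙 (d ∣? k) * g k)) (m≡m%n+[m/n]*n n d))
  (∑-multiples-+ d (n ℕ./ d) (n % d) g (m%n<n n d))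

-- Euler's product for the totient

NoDivisorIn : List ℕ → ℕ → Set
NoDivisorIn ps k = All (_∤ k) ps

noDivisorIn? : ∀ ps → Decidable (NoDivisorIn ps)
noDivisorIn? ps k = all? (λ p → ¬? (p ∣? k)) ps

sifted : List ℕ → ℕ → ℕ
sifted ps N = ∑ N (λ k → 𝟙 (noDivisorIn? ps k))

-- Legendre's recursion. The survivors of `ps` that `p` removes are the `j * p` with `j ≤ M`; no
-- prime in `ps` divides `p`, so `j * p` survives `ps` iff `j` does.
sifted-step : ∀ {p ps} M → Prime p → All Prime ps → All (p <_) ps →
  sifted (p ∷ ps) (M * p) + sifted ps M ≡ sifted ps (M * p)
sifted-step {p} {ps} M pp pps p<ps = begin
  sifted (p ∷ ps) (M * p) + sifted ps M
    ≡⟨ cong (_+_ (sifted (p ∷ ps) (M * p))) (∑-cong M (λ j → 𝟙-cong (noDivisorIn? ps j) (noDivisorIn? ps (j * p)) (to pps p<ps) from)) ⟩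
  sifted (p ∷ ps) (M * p) + ∑ M (λ j → 𝟙 (noDivisorIn? ps (j * p)))
    ≡⟨ cong (λ m → sifted (p ∷ ps) (M * p) + ∑ m (λ j → 𝟙 (noDivisorIn? ps (j * p)))) (m*n/n≡m M p) ⟨
  sifted (p ∷ ps) (M * p) + ∑ (M * p ℕ./ p) (λ j → 𝟙 (noDivisorIn? ps (j * p)))
    ≡⟨ cong (_+_ (sifted (p ∷ ps) (M * p))) (∑-multiples p (M * p) (λ k → 𝟙 (noDivisorIn? ps k))) ⟨
  sifted (p ∷ ps) (M * p) + ∑ (M * p) (λ k → 𝟙 (p ∣? k) * 𝟙 (noDivisorIn? ps k))
    ≡⟨ ∑-+ (M * p) _ _ ⟨
  ∑ (M * p) (λ k → 𝟙 (noDivisorIn? (p ∷ ps) k) + 𝟙 (p ∣? k) * 𝟙 (noDivisorIn? ps k))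
    ≡⟨ ∑-cong (M * p) split ⟩
  sifted ps (M * p) ∎
  where
  open ≡-Reasoning
  instance _ = prime⇒nonZero pp
  to : ∀ {ps j} → All Prime ps → All (p <_) ps → NoDivisorIn ps j → NoDivisorIn ps (j * p)
  to []         []           []         = []
  to (pq ∷ pps) (p<q ∷ p<ps) (q∤j ∷ qs) =
    (λ q∣jp → [ q∤j , >⇒∤ p<q ]′ (euclidsLemma _ p pq q∣jp)) ∷ to pps p<ps qs
  from : ∀ {j} → NoDivisorIn ps (j * p) → NoDivisorIn ps j
  from = All.map (λ q∤jp q∣j → q∤jp (∣m⇒∣m*n p q∣j))
  split : ∀ k → 𝟙 (noDivisorIn? (p ∷ ps) k) + 𝟙 (p ∣? k) * 𝟙 (noDivisorIn? ps k) ≡ 𝟙 (noDivisorIn? ps k)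
  split k = cases (p ∣? k)
    where
    cases : (p∣?k : Dec (p ∣ k)) →
      𝟙 (noDivisorIn? (p ∷ ps) k) + 𝟙 p∣?k * 𝟙 (noDivisorIn? ps k) ≡ 𝟙 (noDivisorIn? ps k)
    cases (yes p∣k) = cong₂ _+_ (𝟙-false (noDivisorIn? (p ∷ ps) k) (λ { (p∤k ∷ _) → p∤k p∣k })) (*-identityˡ _)
    cases (no  p∤k) = trans (+-identityʳ _) (𝟙-cong (noDivisorIn? (p ∷ ps) k) (noDivisorIn? ps k) (λ { (_ ∷ qs) → qs }) (p∤k ∷_))

divisors-of-cofactor : ∀ {p M ps} → All Prime ps → All (_∤ p) ps → All (_∣ M * p) ps → All (_∣ M) ps
divisors-of-cofactor [] [] [] = []
divisors-of-cofactor {p} {M} (pq ∷ pps) (q∤p ∷ ps∤p) (q∣Mp ∷ ps∣Mp) =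
  [ id , (λ q∣p → contradiction q∣p q∤p) ]′ (euclidsLemma M p pq q∣Mp)
  ∷ divisors-of-cofactor pps ps∤p ps∣Mp

larger∤ : ∀ {p ps} .{{_ : NonZero p}} → All (p <_) ps → All (_∤ p) ps
larger∤ = All.map >⇒∤

-- Since every sifting prime divides `N`, the count is exactly `N ∏ (1 - 1/p)`, with no rounding.
-- With `N = M * p`, the formulas for the tail at `M * p` and at `M` are subtracted, the subtraction
-- being a cancellation of `M * Φ`.
sifted-formula : ∀ {ps} N → All Prime ps → AllPairs _<_ ps → All (_∣ N) ps →
  sifted ps N * product ps ≡ N * product (map pred ps)
sifted-formula {[]} N [] [] [] = cong (_* 1) (∑-1 N)
sifted-formula {zero ∷ ps} N (pp ∷ _) _ _ = contradiction pp ¬prime[0]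
sifted-formula {p@(suc p-1) ∷ ps} N (pp ∷ pps) (p<ps ∷ ps↗) (divides-refl M ∷ ps∣) =
  trans (swap (sifted (p ∷ ps) N) p (product ps)) (trans (cong (_* p) (+-cancelʳ-≡ (M * Φ) _ _ (begin
    c * P + M * Φ            ≡⟨ cong (_+_ (c * P)) (sifted-formula M pps ps↗ ps∣M) ⟨
    c * P + a * P            ≡⟨ *-distribʳ-+ P c a ⟨
    (c + a) * P              ≡⟨ cong (_* P) (sifted-step M pp pps p<ps) ⟩
    b * P                    ≡⟨ sifted-formula (M * p) pps ps↗ ps∣ ⟩
    M * p * Φ                ≡⟨ expand M p-1 Φ ⟩
    M * (p-1 * Φ) + M * Φ    ∎))) (swap′ M (p-1 * Φ) p))
  where
  open ≡-Reasoning
  P = product ps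
  Φ = product (map pred ps)
  a = sifted ps M
  b = sifted ps (M * p)
  c = sifted (p ∷ ps) (M * p)
  ps∣M = divisors-of-cofactor pps (larger∤ p<ps) ps∣
  swap : ∀ c p P → c * (p * P) ≡ c * P * p
  swap = solve-∀
  swap′ : ∀ m x p → m * x * p ≡ m * p * x
  swap′ = solve-∀
  expand : ∀ m p x → m * suc p * x ≡ m * (p * x) + m * x
  expand = solve-∀

product-of-primes∣ : ∀ {ps} N → All Prime ps → AllPairs _<_ ps → All (_∣ N) ps → product ps ∣ N
product-of-primes∣ N [] [] [] = 1∣ N
product-of-primes∣ {p ∷ ps} N (pp ∷ pps) (p<ps ∷ ps↗) (divides-refl M ∷ ps∣) =
  subst (p * product ps ∣_) (*-comm p M) (*-monoʳ-∣ p (product-of-primes∣ M pps ps↗ (divisors-of-cofactor pps (larger∤ {{prime⇒nonZero pp}} p<ps) ps∣)))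

-- The i-th smallest prime exceeds i, so ∏ p/(p-1) ≤ ∏ (i+1)/i; the induction runs
-- over the tail of the list, whose primes exceed j.
product≤length*product-pred : ∀ j {ps} → AllPairs _<_ ps → All (j <_) ps →
  j * product ps ≤ (j + length ps) * product (map pred ps)
product≤length*product-pred j [] [] = ≤-reflexive (cong (_* 1) (sym (+-identityʳ j)))
product≤length*product-pred j {suc p ∷ ps} (p<ps ∷ ps↗) (s≤s j≤p ∷ _) = begin
  j * (suc p * P)                         ≤⟨ *-monoʳ-≤ j (product≤length*product-pred (suc p) ps↗ p<ps) ⟩
  j * ((suc p + l) * Φ)                   ≡⟨ *-assoc j (suc p + l) Φ ⟨
  j * (suc p + l) * Φ                     ≤⟨ *-monoˡ-≤ Φ (factor j l j≤p) ⟩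
  (j + suc l) * p * Φ                     ≡⟨ *-assoc (j + suc l) p Φ ⟩
  (j + suc l) * (p * Φ)                   ∎
  where
  open ≤-Reasoning
  P = product ps
  Φ = product (map pred ps)
  l = length ps
  factor : ∀ j l {p} → j ≤ p → j * (suc p + l) ≤ (j + suc l) * p
  factor j l j≤p with m≤n⇒∃[o]m+o≡n j≤p
  -- With `p = j + o` the two sides differ by exactly `o * suc l`.
  ... | o , refl = m+n≤o⇒m≤o (j * (suc (j + o) + l)) {o * suc l} (≤-reflexive (eq j l o))
    where
    eq : ∀ j l o → j * (suc (j + o) + l) + o * suc l ≡ (j + suc l) * (j + o)
    eq = solve-∀

-- R n is by definition the product of this list.
primeDivisors : ℕ → List ℕ
primeDivisors n = filter (λ p → prime? p ×-dec (p ∣? n)) (applyUpTo suc n)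

ω : ℕ → ℕ
ω n = length (primeDivisors n)

applyUpTo-suc-ascending : ∀ n → AllPairs _<_ (applyUpTo suc n)
applyUpTo-suc-ascending n = AllPairs.applyUpTo⁺₁ suc n (λ i<j _ → s≤s i<j)

primeDivisors-ascending : ∀ n → AllPairs _<_ (primeDivisors n)
primeDivisors-ascending n = AllPairs.filter⁺ _ (applyUpTo-suc-ascending n)

primeDivisors-prime×∣ : ∀ n → All (λ p → Prime p × p ∣ n) (primeDivisors n)
primeDivisors-prime×∣ n = All.all-filter (λ p → prime? p ×-dec (p ∣? n)) (applyUpTo suc n)

primeDivisors-prime : ∀ n → All Prime (primeDivisors n)
primeDivisors-prime n = All.map proj₁ (primeDivisors-prime×∣ n)

∈-primeDivisors : ∀ {p n} .{{_ : NonZero n}} → Prime p → p ∣ n → p ∈ primeDivisors n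
∈-primeDivisors {zero}  pp p∣n = contradiction pp ¬prime[0]
∈-primeDivisors {suc p} {n} pp p∣n = ∈-filter⁺ (λ p → prime? p ×-dec (p ∣? n)) (∈-applyUpTo⁺ suc (∣⇒≤ p∣n)) (pp , p∣n)

∃-prime-divisor : ∀ n .{{_ : NonZero n}} → n ≢ 1 → ∃ λ p → Prime p × p ∣ n
∃-prime-divisor n n≢1 with factorise n
... | record { factors = [] ; isFactorisation = eq } = contradiction eq n≢1
... | record { factors = p ∷ ps ; isFactorisation = eq ; factorsPrime = pp ∷ _ } =
  p , pp , subst (p ∣_) (sym eq) (m∣m*n (product ps))

-- Sums and products over a filtered initial segment

module _ {P : Pred ℕ 0ℓ} (P? : Decidable P) where

  private
    kept : ℕ → List ℕ
    kept n = filter P? (applyUpTo suc n)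

    kept-suc : ∀ n → kept (suc n) ≡ kept n ++ filter P? (suc n ∷ [])
    kept-suc n = trans (cong (filter P?) (sym (applyUpTo-∷ʳ suc n))) (filter-++ P? (applyUpTo suc n) (suc n ∷ []))

  filter-suc-accept : ∀ {n} → P (suc n) → kept (suc n) ≡ kept n ∷ʳ suc n
  filter-suc-accept {n} p = trans (kept-suc n) (cong (kept n ++_) (filter-accept P? p))

  filter-suc-reject : ∀ {n} → ¬ P (suc n) → kept (suc n) ≡ kept n
  filter-suc-reject {n} ¬p = trans (kept-suc n) (trans (cong (kept n ++_) (filter-reject P? ¬p)) (++-identityʳ (kept n)))

  sum-filter : ∀ f n → sum (map f (kept n)) ≡ ∑ n (λ k → 𝟙 (P? k) * f k)
  sum-filter f zero = refl
  sum-filter f (suc n) = by (P? (suc n))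
    where
    open ≡-Reasoning
    by : (d : Dec (P (suc n))) → sum (map f (kept (suc n))) ≡ ∑ n (λ k → 𝟙 (P? k) * f k) + 𝟙 d * f (suc n)
    by (yes p) = begin
      sum (map f (kept (suc n)))                       ≡⟨ cong (sum ∘ map f) (filter-suc-accept p) ⟩
      sum (map f (kept n ∷ʳ suc n))                    ≡⟨ cong sum (map-++ f (kept n) (suc n ∷ [])) ⟩
      sum (map f (kept n) ++ f (suc n) ∷ [])           ≡⟨ sum-++ (map f (kept n)) (f (suc n) ∷ []) ⟩
      sum (map f (kept n)) + 1 * f (suc n)             ≡⟨ cong (_+ 1 * f (suc n)) (sum-filter f n) ⟩
      ∑ n (λ k → 𝟙 (P? k) * f k) + 1 * f (suc n)       ∎
    by (no ¬p) = trans (cong (sum ∘ map f) (filter-suc-reject ¬p)) (trans (sum-filter f n) (sym (+-identityʳ _)))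

  -- The `i`-th kept number is at least `i`: when `suc n` is kept, at most `n` numbers precede it.
  length!≤product : ∀ n → length (kept n) ! ≤ product (kept n)
  length!≤product zero    = ≤-refl
  length!≤product (suc n) = by (P? (suc n))
    where
    open ≤-Reasoning
    length≤n : length (kept n) ≤ n
    length≤n = ≤-trans (length-filter P? (applyUpTo suc n)) (≤-reflexive (length-applyUpTo suc n))
    by : Dec (P (suc n)) → length (kept (suc n)) ! ≤ product (kept (suc n))
    by (no ¬p) = subst (λ ks → length ks ! ≤ product ks) (sym (filter-suc-reject ¬p)) (length!≤product n)
    by (yes p) = subst (λ ks → length ks ! ≤ product ks) (sym (filter-suc-accept p)) (begin
      length (kept n ∷ʳ suc n) !            ≡⟨ cong _! (trans (length-++ (kept n)) (+-comm (length (kept n)) 1)) ⟩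
      suc (length (kept n)) * length (kept n) ! ≤⟨ *-mono-≤ (s≤s length≤n) (length!≤product n) ⟩
      suc n * product (kept n)              ≡⟨ *-comm (suc n) _ ⟩
      product (kept n) * suc n              ≡⟨ cong (product (kept n) *_) (*-identityʳ (suc n)) ⟨
      product (kept n) * (suc n * 1)        ≡⟨ product-++ (kept n) (suc n ∷ []) ⟨
      product (kept n ∷ʳ suc n)             ∎)

length≡sum : ∀ (ks : List ℕ) → length ks ≡ sum (map (λ _ → 1) ks)
length≡sum []       = refl
length≡sum (k ∷ ks) = cong suc (length≡sum ks)

φ≡∑ : ∀ n → φ n ≡ ∑ n (λ k → 𝟙 (coprime? k n))
φ≡∑ n = trans (length≡sum (filter (λ k → coprime? k n) (applyUpTo suc n))) (trans (sum-filter (λ k → coprime? k n) (λ _ → 1) n) (∑-cong n (λ k → *-identityʳ _)))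

-- A common divisor `d ≠ 1` of `k` and `n` would have a prime factor among the sifting primes.
sifted≤φ : ∀ n .{{_ : NonZero n}} → sifted (primeDivisors n) n ≤ φ n
sifted≤φ n = subst (sifted (primeDivisors n) n ≤_) (sym (φ≡∑ n)) (∑-mono-≤ n (λ k _ → go k))
  where
  coprime : ∀ k → NoDivisorIn (primeDivisors n) k → Coprime k n
  coprime k ∤k {d} (d∣k , d∣n) with d ≟ 1
  ... | yes d≡1 = d≡1
  ... | no  d≢1 with ∃-prime-divisor d {{d≢0}} d≢1
    where
    d≢0 : NonZero d
    d≢0 = ≢-nonZero (λ { refl → ≢-nonZero⁻¹ n (0∣⇒≡0 d∣n) })
  ... | p , pp , p∣d = contradiction (∣-trans p∣d d∣k) (All.lookup ∤k (∈-primeDivisors pp (∣-trans p∣d d∣n)))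
  go : ∀ k → 𝟙 (noDivisorIn? (primeDivisors n) k) ≤ 𝟙 (coprime? k n)
  go k with noDivisorIn? (primeDivisors n) k | coprime? k n
  ... | yes ∤k | yes _ = ≤-refl
  ... | yes ∤k | no ¬c = ⊥-elim (¬c (coprime k ∤k))
  ... | no _   | _     = z≤n

-- `Φ / P` is the proportion that survives sifting, and `product≤length*product-pred` at `j = 1`
-- bounds it below by `1 / (1 + ω n)`.
n≤[1+ω]φ : ∀ n .{{_ : NonZero n}} → n ≤ suc (ω n) * φ n
n≤[1+ω]φ n = *-cancelʳ-≤ n (suc (ω n) * φ n) P {{P≢0}} (begin
  n * P                          ≡⟨ cong (n *_) (*-identityˡ P) ⟨
  n * (1 * P)                    ≤⟨ *-monoʳ-≤ n (product≤length*product-pred 1 (primeDivisors-ascending n)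
                                      (All.map (λ pp → nonTrivial⇒n>1 _ {{prime⇒nonTrivial pp}}) (primeDivisors-prime n))) ⟩
  n * (suc (ω n) * Φ)            ≡⟨ shuffle n (suc (ω n)) Φ ⟩
  suc (ω n) * (n * Φ)            ≡⟨ cong (suc (ω n) *_) (sifted-formula n (primeDivisors-prime n) (primeDivisors-ascending n)
                                      (All.map proj₂ (primeDivisors-prime×∣ n))) ⟨
  suc (ω n) * (s * P)            ≤⟨ *-monoʳ-≤ (suc (ω n)) (*-monoˡ-≤ P (sifted≤φ n)) ⟩
  suc (ω n) * (φ n * P)          ≡⟨ *-assoc (suc (ω n)) (φ n) P ⟨
  suc (ω n) * φ n * P            ∎)
  where
  open ≤-Reasoning
  P = product (primeDivisors n)
  Φ = product (map pred (primeDivisors n))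
  s = sifted (primeDivisors n) n
  P≢0 : NonZero P
  P≢0 = R-nonZero n
  shuffle : ∀ a b c → a * (b * c) ≡ b * (a * c)
  shuffle = solve-∀

^-*-distrib : ∀ m n k → (m * n) ^ k ≡ m ^ k * n ^ k
^-*-distrib m n zero    = refl
^-*-distrib m n (suc k) = trans (cong (m * n *_) (^-*-distrib m n k)) (interchange m n (m ^ k) (n ^ k))
  where
  interchange : ∀ a b c d → a * b * (c * d) ≡ a * c * (b * d)
  interchange = solve-∀

-- Radicals

product≤R : ∀ {ps} n .{{_ : NonZero n}} → All Prime ps → AllPairs _<_ ps → All (_∣ n) ps → product ps ≤ R n
product≤R n pps ps↗ ps∣n = ∣⇒≤ {{R-nonZero n}} (product-of-primes∣ (R n) pps ps↗ (All.zipWith (λ (pp , p∣n) →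
  ∈⇒∣product (∈-primeDivisors pp p∣n)) (pps , ps∣n)))

R-mono-∣ : ∀ {m n} .{{_ : NonZero n}} → m ∣ n → R m ≤ R n
R-mono-∣ {m} {n} m∣n = product≤R n (primeDivisors-prime m) (primeDivisors-ascending m)
  (All.map (λ (_ , p∣m) → ∣-trans p∣m m∣n) (primeDivisors-prime×∣ m))

-- Write `R (m * p) = M * p`. The primes of `m` divide `M * p` and differ from `p`, so they divide
-- `M`, and hence so does their product.
p*R≤R : ∀ {p} m .{{_ : NonZero (m * p)}} → Prime p → p ∤ m → p * R m ≤ R (m * p)
p*R≤R {p} m pp p∤m with ∈⇒∣product (∈-primeDivisors pp (n∣m*n m {p}))
... | divides M eq = subst (p * R m ≤_) (sym (trans eq (*-comm M p))) (*-monoʳ-≤ p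
  (∣⇒≤ {{M≢0}} (product-of-primes∣ M (primeDivisors-prime m) (primeDivisors-ascending m)
    (divisors-of-cofactor (primeDivisors-prime m) (All.map ∤p (primeDivisors-prime×∣ m)) (All.map ∣Mp (primeDivisors-prime×∣ m))))))
  where
  M≢0 : NonZero M
  M≢0 = m*n≢0⇒m≢0 M {{subst NonZero eq (R-nonZero (m * p))}}
  ∤p : ∀ {q} → Prime q × q ∣ m → q ∤ p
  ∤p (pq , q∣m) q∣p with prime⇒irreducible pp q∣p
  ... | inj₁ refl = ¬prime[1] pq
  ... | inj₂ refl = p∤m q∣m
  ∣Mp : ∀ {q} → Prime q × q ∣ m → q ∣ M * p
  ∣Mp (pq , q∣m) = subst (_ ∣_) eq (∈⇒∣product (∈-primeDivisors pq (∣m⇒∣m*n p q∣m)))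

LargeSquareDivisor : ℕ → Set
LargeSquareDivisor k = ∃ λ b → b * b ∣ k × k ≤ R k * (b * b)

-- Strong induction on `k`, removing a prime `p`. If `p` divides `k` once, it is charged to the
-- radical by `p*R≤R`; if `p * p` divides `k`, the square moves into `b` and the radical only has to
-- be monotone.
largeSquareDivisor : ∀ k .{{_ : NonZero k}} → LargeSquareDivisor k
largeSquareDivisor k = <-rec (λ k → NonZero k → LargeSquareDivisor k) step k (recompute (nonZero? k) it)
  where
  step : ∀ k → (∀ {j} → j < k → NonZero j → LargeSquareDivisor j) → NonZero k → LargeSquareDivisor k
  step k rec k≢0 with k ≟ 1
  ... | yes refl = 1 , ∣-refl , ≤-refl
  ... | no  k≢1 with ∃-prime-divisor k {{k≢0}} k≢1
  ... | p , pp , divides-refl m with p ∣? m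
  ... | no p∤m = extend (rec m<mp m≢0)
    where
    instance
      mp≢0 : NonZero (m * p)
      mp≢0 = k≢0
      m≢0 : NonZero m
      m≢0 = m*n≢0⇒m≢0 m
    m<mp : m < m * p
    m<mp = m<m*n m p (nonTrivial⇒n>1 p {{prime⇒nonTrivial pp}})
    extend : LargeSquareDivisor m → LargeSquareDivisor (m * p)
    extend (b , b²∣m , m≤) = b , ∣m⇒∣m*n p b²∣m , (begin
      m * p                 ≤⟨ *-monoˡ-≤ p m≤ ⟩
      R m * (b * b) * p     ≡⟨ shuffle (R m) (b * b) p ⟩
      p * R m * (b * b)     ≤⟨ *-monoˡ-≤ (b * b) (p*R≤R m pp p∤m) ⟩
      R (m * p) * (b * b)   ∎)
      where
      open ≤-Reasoning
      shuffle : ∀ x y z → x * y * z ≡ z * x * y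
      shuffle = solve-∀
  ... | yes (divides-refl m′) = extend (rec m′<k m′≢0)
    where
    instance
      mp≢0 : NonZero (m′ * p * p)
      mp≢0 = k≢0
      m≢0 : NonZero (m′ * p)
      m≢0 = m*n≢0⇒m≢0 (m′ * p)
      m′≢0 : NonZero m′
      m′≢0 = m*n≢0⇒m≢0 m′
    m′<k : m′ < m′ * p * p
    m′<k = <-trans (m<m*n m′ p 1<p) (m<m*n (m′ * p) p 1<p)
      where 1<p = nonTrivial⇒n>1 p {{prime⇒nonTrivial pp}}
    extend : LargeSquareDivisor m′ → LargeSquareDivisor (m′ * p * p)
    extend (b , b²∣m′ , m′≤) = b * p , subst₂ _∣_ (square b p) (assoc m′ p) (*-monoˡ-∣ (p * p) b²∣m′) , (begin
      m′ * p * p                             ≡⟨ *-assoc m′ p p ⟩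
      m′ * (p * p)                           ≤⟨ *-monoˡ-≤ (p * p) m′≤ ⟩
      R m′ * (b * b) * (p * p)               ≡⟨ assoc′ (R m′) b p ⟩
      R m′ * (b * p * (b * p))               ≤⟨ *-monoˡ-≤ (b * p * (b * p)) (R-mono-∣ {m′} {m′ * p * p} (∣m⇒∣m*n p (m∣m*n p))) ⟩
      R (m′ * p * p) * (b * p * (b * p))     ∎)
      where
      open ≤-Reasoning
      square : ∀ b p → b * b * (p * p) ≡ b * p * (b * p)
      square = solve-∀
      assoc : ∀ m p → m * (p * p) ≡ m * p * p
      assoc = solve-∀
      assoc′ : ∀ r b p → r * (b * b) * (p * p) ≡ r * (b * p * (b * p))
      assoc′ = solve-∀

-- The logarithmic mass of square divisors

-- A stand-in for `log b`. An offset of 1 would already give `b≤2^w`; the offset 2 ensures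
-- `2 * suc (w c) ≤ 3 * w c`, which keeps the growth factor of the recursion below 4.
w : ℕ → ℕ
w b = 2 + ⌊log₂ b ⌋

b≤2^w : ∀ b → b ≤ 2 ^ w b
b≤2^w b with b ≤? 2 ^ w b
... | yes b≤ = b≤
... | no  b≰ = contradiction (≤-trans (≤-reflexive (sym (⌊log₂[2^n]⌋≡n (w b)))) (⌊log₂⌋-mono-≤ (<⇒≤ (≰⇒> b≰))))
  (<⇒≱ (m≤n+m (suc ⌊log₂ b ⌋) 1))

w-step : ∀ {b c} → ⌊ b /2⌋ ≡ c → w b ≤ suc (w c)
w-step {b} {c} refl rewrite ⌊log₂⌊n/2⌋⌋≡⌊log₂n⌋∸1 b = +-monoʳ-≤ 2 (m≤n+m∸n ⌊log₂ b ⌋ 1)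

-- ⌊n/b²⌋ for b ≥ 1 and the junk value 0 at b = 0
multiplesOfSquare : ℕ → ℕ → ℕ
multiplesOfSquare n zero      = 0
multiplesOfSquare n b@(suc _) = n ℕ./ (b * b)

squareSum : ℕ → ℕ → ℕ
squareSum N n = ∑ N (λ b → w b * multiplesOfSquare n b)

multiplesOfSquare-double : ∀ n c → multiplesOfSquare n (c + c) ≤ multiplesOfSquare (n ℕ./ 4) c
multiplesOfSquare-double n zero = z≤n
multiplesOfSquare-double n c@(suc _) = ≤-reflexive (trans (/-congʳ {m = n} (eq c)) (sym (m/n/o≡m/[n*o] n 4 (c * c))))
  where
  eq : ∀ c → (c + c) * (c + c) ≡ 4 * (c * c)
  eq = solve-∀

multiplesOfSquare-antitone : ∀ n b → multiplesOfSquare n (suc (suc b)) ≤ multiplesOfSquare n (suc b)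
multiplesOfSquare-antitone n b = /-monoʳ-≤ n (*-mono-≤ (n≤1+n (suc b)) (n≤1+n (suc b)))

-- Both weights are at most `suc (w c)`, and both squares are at least `4c²`, so each count is at
-- most that of `c²` in `⌊n/4⌋`.
squareSum-pair : ∀ n c → 1 ≤ c →
  w (c + c) * multiplesOfSquare n (c + c) + w (suc (c + c)) * multiplesOfSquare n (suc (c + c))
    ≤ 3 * (w c * multiplesOfSquare (n ℕ./ 4) c)
squareSum-pair n c@(suc c-1) _ = begin
  w (c + c) * multiplesOfSquare n (c + c) + w (suc (c + c)) * multiplesOfSquare n (suc (c + c))
    ≤⟨ +-mono-≤ (*-mono-≤ (w-step (sym (n≡⌊n+n/2⌋ c))) (multiplesOfSquare-double n c))
                (*-mono-≤ (w-step (sym (n≡⌈n+n/2⌉ c))) (≤-trans (multiplesOfSquare-antitone n (c-1 + c)) (multiplesOfSquare-double n c))) ⟩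
  suc (w c) * a + suc (w c) * a
    ≤⟨ m+n≤o⇒m≤o _ {⌊log₂ c ⌋ * a} (≤-reflexive (eq ⌊log₂ c ⌋ a)) ⟩
  3 * (w c * a) ∎
  where
  open ≤-Reasoning
  a = multiplesOfSquare (n ℕ./ 4) c
  eq : ∀ l a → suc (2 + l) * a + suc (2 + l) * a + l * a ≡ 3 * ((2 + l) * a)
  eq = solve-∀

-- `2 ^ M - 1`. These lengths are stable under splitting the range into `1` and the pairs
-- `2c, 2c+1`, so the induction has no ragged end.
mersenne : ℕ → ℕ
mersenne zero  = 0
mersenne (suc M) = suc (mersenne M + mersenne M)

n≤mersenne : ∀ n → n ≤ mersenne n
n≤mersenne zero    = z≤n
n≤mersenne (suc n) = s≤s (≤-trans (n≤mersenne n) (m≤m+n _ _))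

-- Pairing b = 2c with b = 2c+1 gives S(n) ≤ 2n + 3 S(⌊n/4⌋).
squareSum≤8n : ∀ M n → squareSum (mersenne M) n ≤ 8 * n
squareSum≤8n zero    n = z≤n
squareSum≤8n (suc M) n = begin
  squareSum (suc (N + N)) n             ≡⟨ ∑-pairs N _ ⟩
  w 1 * (n ℕ./ 1) + ∑ N (λ c → w (c + c) * multiplesOfSquare n (c + c) + w (suc (c + c)) * multiplesOfSquare n (suc (c + c)))
    ≤⟨ +-mono-≤ (≤-reflexive (cong (2 *_) (n/1≡n n))) (∑-mono-≤ N (squareSum-pair n)) ⟩
  2 * n + ∑ N (λ c → 3 * (w c * multiplesOfSquare (n ℕ./ 4) c)) ≡⟨ cong (_+_ (2 * n)) (∑-*ˡ N 3 (λ c → w c * multiplesOfSquare (n ℕ./ 4) c)) ⟩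
  -- The constant 8 is the fixed point of `C = 2 + 3C/4`.
  2 * n + 3 * squareSum N (n ℕ./ 4)     ≤⟨ +-monoʳ-≤ (2 * n) (*-monoʳ-≤ 3 (squareSum≤8n M (n ℕ./ 4))) ⟩
  2 * n + 3 * (8 * (n ℕ./ 4))           ≡⟨ cong (_+_ (2 * n)) (eq (n ℕ./ 4)) ⟩
  2 * n + 6 * (n ℕ./ 4 * 4)             ≤⟨ +-monoʳ-≤ (2 * n) (*-monoʳ-≤ 6 (m/n*n≤m n 4)) ⟩
  2 * n + 6 * n                         ≡⟨ *-distribʳ-+ n 2 6 ⟨
  8 * n                                 ∎
  where
  open ≤-Reasoning
  N = mersenne M
  eq : ∀ q → 3 * (8 * q) ≡ 6 * (q * 4)
  eq = solve-∀

-- Every `b` with `b * b ∣ k` contributes, not only the one chosen by `largeSquareDivisor`: the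
-- overcount depends on divisibility alone, so its total over `k` is found by exchanging the sums.
-- The cutoff `mersenne n ≥ n` misses no such `b` for `1 ≤ k ≤ n` and fits `squareSum≤8n`.
squareExponent : ℕ → ℕ → ℕ
squareExponent n k = ∑ (mersenne n) (λ b → 𝟙 (b * b ∣? k) * w b)

∑-squareExponent : ∀ n → ∑ n (squareExponent n) ≤ 8 * n
∑-squareExponent n = ≤-trans (≤-trans (≤-reflexive (∑-swap n (mersenne n) _)) (∑-mono-≤ (mersenne n) column)) (squareSum≤8n n n)
  where
  column : ∀ b → 1 ≤ b → ∑ n (λ k → 𝟙 (b * b ∣? k) * w b) ≤ w b * multiplesOfSquare n b
  column b@(suc _) _ = ≤-reflexive (begin
    ∑ n (λ k → 𝟙 (b * b ∣? k) * w b)        ≡⟨ ∑-multiples (b * b) n (λ _ → w b) ⟩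
    ∑ (n ℕ./ (b * b)) (λ _ → w b)           ≡⟨ ∑-cong (n ℕ./ (b * b)) (λ _ → sym (*-identityʳ (w b))) ⟩
    ∑ (n ℕ./ (b * b)) (λ _ → w b * 1)       ≡⟨ ∑-*ˡ (n ℕ./ (b * b)) (w b) (λ _ → 1) ⟩
    w b * ∑ (n ℕ./ (b * b)) (λ _ → 1)       ≡⟨ cong (w b *_) (∑-1 (n ℕ./ (b * b))) ⟩
    w b * (n ℕ./ (b * b))                   ∎)
    where open ≡-Reasoning

k≤R*4^e : ∀ {n k} → 1 ≤ k → k ≤ n → k ≤ R k * 4 ^ squareExponent n k
k≤R*4^e {n} {k@(suc _)} _ k≤n with largeSquareDivisor k
... | zero , divides q eq , _ = contradiction (trans eq (*-zeroʳ q)) (λ ())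
... | b@(suc b-1) , b²∣k , k≤ = begin
  k                                 ≤⟨ k≤ ⟩
  R k * (b * b)                     ≤⟨ *-monoʳ-≤ (R k) (*-mono-≤ (b≤2^w b) (b≤2^w b)) ⟩
  R k * (2 ^ w b * 2 ^ w b)         ≡⟨ cong (R k *_) (^-*-distrib 2 2 (w b)) ⟨
  R k * 4 ^ w b                     ≤⟨ *-monoʳ-≤ (R k) (^-monoʳ-≤ 4 w≤e) ⟩
  R k * 4 ^ squareExponent n k      ∎
  where
  open ≤-Reasoning
  w≤e : w b ≤ squareExponent n k
  w≤e = ≤-trans (≤-reflexive (sym (trans (cong (_* w b) (𝟙-true (b * b ∣? k) b²∣k)) (*-identityˡ (w b)))))
    (term≤∑ (λ b → 𝟙 (b * b ∣? k) * w b) (s≤s z≤n)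
      (≤-trans (≤-trans (m≤m*n b b) (∣⇒≤ b²∣k)) (≤-trans k≤n (n≤mersenne n))))

-- Products over the totatives

-- For `m ≥ 1` this reads `(1 + 1/m)^k ≤ 1 + k/m + (k/m)²`, an analogue of `e^x ≤ 1 + x + x²` on
-- `[0, 1]`. At `k = m` the right side is 3.
[1+m]^k-bound : ∀ m {k} → k ≤ m → suc m ^ k * (m * m) ≤ m ^ k * (m * m + k * m + k * k)
[1+m]^k-bound m {zero}  _   = ≤-reflexive (eq m)
  where
  eq : ∀ m → 1 * (m * m) ≡ 1 * (m * m + 0 + 0)
  eq = solve-∀
[1+m]^k-bound m {suc k} 1+k≤m = begin
  suc m * suc m ^ k * (m * m)                        ≡⟨ *-assoc (suc m) (suc m ^ k) (m * m) ⟩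
  suc m * (suc m ^ k * (m * m))                      ≤⟨ *-monoʳ-≤ (suc m) ([1+m]^k-bound m (<⇒≤ 1+k≤m)) ⟩
  suc m * (m ^ k * (m * m + k * m + k * k))          ≡⟨ shuffle (suc m) (m ^ k) _ ⟩
  m ^ k * (suc m * (m * m + k * m + k * k))          ≤⟨ *-monoʳ-≤ (m ^ k) quadratic ⟩
  m ^ k * (m * (m * m + suc k * m + suc k * suc k))  ≡⟨ assoc (m ^ k) m _ ⟩
  m * m ^ k * (m * m + suc k * m + suc k * suc k)    ∎
  where
  open ≤-Reasoning
  shuffle : ∀ a b c → a * (b * c) ≡ b * (a * c)
  shuffle = solve-∀
  assoc : ∀ a b c → a * (b * c) ≡ b * a * c
  assoc = solve-∀
  expand : ∀ m k → suc m * (m * m + k * m + k * k) + k * m + m ≡ m * (m * m + suc k * m + suc k * suc k) + k * k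
  expand = solve-∀
  quadratic : suc m * (m * m + k * m + k * k) ≤ m * (m * m + suc k * m + suc k * suc k)
  quadratic = +-cancelʳ-≤ (k * k) _ _ (begin
    suc m * (m * m + k * m + k * k) + k * k       ≤⟨ +-monoʳ-≤ (suc m * (m * m + k * m + k * k)) (*-monoʳ-≤ k (<⇒≤ 1+k≤m)) ⟩
    suc m * (m * m + k * m + k * k) + k * m       ≤⟨ m≤m+n _ m ⟩
    suc m * (m * m + k * m + k * k) + k * m + m   ≡⟨ expand m k ⟩
    m * (m * m + suc k * m + suc k * suc k) + k * k ∎)

[1+m]^m≤3*m^m : ∀ m → suc m ^ m ≤ 3 * m ^ m
[1+m]^m≤3*m^m zero        = s≤s z≤n
[1+m]^m≤3*m^m m@(suc _) = *-cancelʳ-≤ _ _ (m * m) (≤-trans ([1+m]^k-bound m ≤-refl) (≤-reflexive (eq (m ^ m) (m * m))))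
  where
  eq : ∀ a b → a * (b + b + b) ≡ 3 * a * b
  eq = solve-∀

m^m≤3^m*m! : ∀ m → m ^ m ≤ 3 ^ m * m !
m^m≤3^m*m! zero    = ≤-refl
m^m≤3^m*m! (suc m) = begin
  suc m * suc m ^ m              ≤⟨ *-monoʳ-≤ (suc m) (≤-trans ([1+m]^m≤3*m^m m) (*-monoʳ-≤ 3 (m^m≤3^m*m! m))) ⟩
  suc m * (3 * (3 ^ m * m !))    ≡⟨ shuffle (suc m) 3 (3 ^ m) (m !) ⟩
  3 * 3 ^ m * (suc m * m !)      ∎
  where
  open ≤-Reasoning
  shuffle : ∀ a b c d → a * (b * (c * d)) ≡ b * c * (a * d)
  shuffle = solve-∀

-- The two ranges differ only in the candidate `n`, which is not coprime to itself once `n ≥ 2`.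
φ≡length-totatives : ∀ {n} → 2 ≤ n → φ n ≡ length (totatives n)
φ≡length-totatives {n@(suc m)} (s≤s 1≤m) =
  cong length (filter-suc-reject (λ k → coprime? k n) (λ c → <⇒≢ (s≤s 1≤m) (sym (c (∣-refl , ∣-refl)))))

product≤product-R*4^sum : ∀ {ks} (e : ℕ → ℕ) → All (λ k → k ≤ R k * 4 ^ e k) ks →
  product ks ≤ product (map R ks) * 4 ^ sum (map e ks)
product≤product-R*4^sum e [] = ≤-refl
product≤product-R*4^sum {k ∷ ks} e (k≤ ∷ ks≤) = begin
  k * product ks                                         ≤⟨ *-mono-≤ k≤ (product≤product-R*4^sum e ks≤) ⟩
  R k * 4 ^ e k * (Π * 4 ^ Σ)                            ≡⟨ interchange (R k) (4 ^ e k) Π (4 ^ Σ) ⟩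
  R k * Π * (4 ^ e k * 4 ^ Σ)                            ≡⟨ cong (R k * Π *_) (^-distribˡ-+-* 4 (e k) Σ) ⟨
  R k * Π * 4 ^ (e k + Σ)                                ∎
  where
  open ≤-Reasoning
  Π = product (map R ks)
  Σ = sum (map e ks)
  interchange : ∀ a b c d → a * b * (c * d) ≡ a * c * (b * d)
  interchange = solve-∀

product-totatives≤ : ∀ n → product (totatives n) ≤ product (map R (totatives n)) * 4 ^ (8 * n)
product-totatives≤ n = ≤-trans (product≤product-R*4^sum (squareExponent m) (All.filter⁺ (λ k → coprime? k n) bounds))
  (*-monoʳ-≤ (product (map R (totatives n))) (^-monoʳ-≤ 4 (begin
    sum (map (squareExponent m) (totatives n))               ≡⟨ sum-filter (λ k → coprime? k n) (squareExponent m) m ⟩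
    ∑ m (λ k → 𝟙 (coprime? k n) * squareExponent m k)        ≤⟨ ∑-mono-≤ m (λ k _ → ≤-trans (*-monoˡ-≤ (squareExponent m k) (𝟙≤1 (coprime? k n))) (≤-reflexive (*-identityˡ _))) ⟩
    ∑ m (squareExponent m)                                   ≤⟨ ∑-squareExponent m ⟩
    8 * m                                                    ≤⟨ *-monoʳ-≤ 8 (m∸n≤m n 1) ⟩
    8 * n                                                    ∎)))
  where
  open ≤-Reasoning
  m = n ∸ 1
  bounds : All (λ k → k ≤ R k * 4 ^ squareExponent m k) (applyUpTo suc m)
  bounds = All.applyUpTo⁺₁ suc m (λ i<m → k≤R*4^e (s≤s z≤n) i<m)
  𝟙≤1 : ∀ {p} {P : Set p} (P? : Dec P) → 𝟙 P? ≤ 1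
  𝟙≤1 (yes _) = ≤-refl
  𝟙≤1 (no  _) = z≤n

n<4^n : ∀ n → n < 4 ^ n
n<4^n zero    = s≤s z≤n
n<4^n (suc n) = <-≤-trans (s≤s (n<4^n n)) (+-mono-≤ (m^n>0 4 n) (m≤m+n (4 ^ n) _))

-- `n ≤ c * m` enters twice: in the base, to reach `m ^ m` and so `m !`, and in the exponent
-- `8 * n`, so that every lost factor becomes an `m`-th power.
n^φ≤ : ∀ {n} → 2 ≤ n → n ^ φ n ≤ (4 ^ (10 * suc (ω n))) ^ φ n * product (map R (totatives n))
n^φ≤ {n} 2≤n = begin
  n ^ m                                   ≤⟨ ^-monoˡ-≤ m n≤cm ⟩
  (c * m) ^ m                             ≡⟨ ^-*-distrib c m m ⟩
  c ^ m * m ^ m                           ≤⟨ *-monoʳ-≤ (c ^ m) (m^m≤3^m*m! m) ⟩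
  c ^ m * (3 ^ m * m !)                   ≤⟨ *-monoʳ-≤ (c ^ m) (*-monoʳ-≤ (3 ^ m) m!≤) ⟩
  c ^ m * (3 ^ m * (Π * 4 ^ (8 * n)))     ≤⟨ *-monoʳ-≤ (c ^ m) (*-monoʳ-≤ (3 ^ m) (*-monoʳ-≤ Π (^-monoʳ-≤ 4 (*-monoʳ-≤ 8 n≤cm)))) ⟩
  c ^ m * (3 ^ m * (Π * 4 ^ (8 * (c * m)))) ≡⟨ cong (λ x → c ^ m * (3 ^ m * (Π * x))) (trans (cong (4 ^_) (sym (*-assoc 8 c m))) (sym (^-*-assoc 4 (8 * c) m))) ⟩
  c ^ m * (3 ^ m * (Π * (4 ^ (8 * c)) ^ m)) ≡⟨ shuffle (c ^ m) (3 ^ m) Π _ ⟩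
  c ^ m * (3 ^ m * (4 ^ (8 * c)) ^ m) * Π ≡⟨ cong (_* Π) (trans (cong (c ^ m *_) (sym (^-*-distrib 3 (4 ^ (8 * c)) m))) (sym (^-*-distrib c _ m))) ⟩
  (c * (3 * 4 ^ (8 * c))) ^ m * Π         ≤⟨ *-monoˡ-≤ Π (^-monoˡ-≤ m base) ⟩
  (4 ^ (10 * c)) ^ m * Π                  ∎
  where
  open ≤-Reasoning
  m = φ n
  c = suc (ω n)
  Π = product (map R (totatives n))
  n≤cm : n ≤ c * m
  n≤cm = n≤[1+ω]φ n {{>-nonZero (≤-trans (s≤s z≤n) 2≤n)}}
  m!≤ : m ! ≤ Π * 4 ^ (8 * n)
  m!≤ = ≤-trans (subst (λ l → l ! ≤ product (totatives n)) (sym (φ≡length-totatives 2≤n)) (length!≤product (λ k → coprime? k n) (n ∸ 1)))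
    (product-totatives≤ n)
  shuffle : ∀ a b c d → a * (b * (c * d)) ≡ a * (b * d) * c
  shuffle = solve-∀
  -- The exponent 10 is 8 from the square divisors, plus 1 for `c ≤ 4 ^ c`, plus 1 for `3 ≤ 4 ^ c`.
  base : c * (3 * 4 ^ (8 * c)) ≤ 4 ^ (10 * c)
  base = begin
    c * (3 * 4 ^ (8 * c))            ≤⟨ *-mono-≤ (<⇒≤ (n<4^n c)) (*-monoˡ-≤ (4 ^ (8 * c)) (≤-trans (n≤1+n 3) (*-monoʳ-≤ 4 (m^n>0 4 (ω n))))) ⟩
    4 ^ c * (4 ^ c * 4 ^ (8 * c))    ≡⟨ cong (4 ^ c *_) (^-distribˡ-+-* 4 c (8 * c)) ⟨
    4 ^ c * 4 ^ (9 * c)              ≡⟨ ^-distribˡ-+-* 4 c (9 * c) ⟨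
    4 ^ (10 * c)                     ∎

-- At most `D` entries are `≤ D`, and the budget `D ^ D` pays for them, `j` recording how far it is
-- spent. Each entry above `D` pays for its own factor `D`.
D^length≤ : ∀ D .{{_ : NonZero D}} {j ps} → j ≤ D → AllPairs _<_ ps → All (j <_) ps → D ^ (j + length ps) ≤ D ^ D * product ps
D^length≤ D {j} j≤D [] [] = ≤-trans (^-monoʳ-≤ D (≤-trans (≤-reflexive (+-identityʳ j)) j≤D)) (≤-reflexive (sym (*-identityʳ (D ^ D))))
D^length≤ D {j} {p ∷ ps} j≤D (p<ps ∷ ps↗) (j<p ∷ _) with p ≤? D
... | yes p≤D = begin
  D ^ (j + suc (length ps))     ≤⟨ ^-monoʳ-≤ D (≤-trans (≤-reflexive (+-suc j _)) (+-monoˡ-≤ (length ps) j<p)) ⟩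
  D ^ (p + length ps)           ≤⟨ D^length≤ D p≤D ps↗ p<ps ⟩
  D ^ D * product ps            ≤⟨ *-monoʳ-≤ (D ^ D) (m≤n*m (product ps) p {{>-nonZero (≤-<-trans z≤n j<p)}}) ⟩
  D ^ D * (p * product ps)      ∎
  where open ≤-Reasoning
... | no p≰D = begin
  D ^ (j + suc (length ps))     ≡⟨ ^-distribˡ-+-* D j _ ⟩
  D ^ j * D ^ suc (length ps)   ≤⟨ *-mono-≤ (^-monoʳ-≤ D j≤D) (large (<⇒≤ (≰⇒> p≰D) ∷ All.map (λ p<q → <⇒≤ (<-trans (≰⇒> p≰D) p<q)) p<ps)) ⟩
  D ^ D * (p * product ps)      ∎
  where
  open ≤-Reasoning
  large : ∀ {qs} → All (D ≤_) qs → D ^ length qs ≤ product qs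
  large []           = ≤-refl
  large (D≤q ∷ D≤qs) = *-mono-≤ D≤q (large D≤qs)

D^ω≤D^D*R : ∀ D .{{_ : NonZero D}} n → D ^ ω n ≤ D ^ D * R n
D^ω≤D^D*R D n = D^length≤ D z≤n (primeDivisors-ascending n)
  (All.map (λ pp → >-nonZero⁻¹ _ {{prime⇒nonZero pp}}) (primeDivisors-prime n))

-- Integer roots and the inequality between `t`-th powers

∃-floorRoot : ∀ m .{{_ : NonZero m}} B .{{_ : NonZero B}} → ∃ λ s → 1 ≤ s × s ^ m ≤ B × B < suc s ^ m
∃-floorRoot m (suc zero) = 1 , ≤-refl , ≤-reflexive (^-zeroˡ m) , subst (_< 2 ^ m) (^-zeroˡ m) (^-monoˡ-< m (s≤s (s≤s z≤n)))
∃-floorRoot m (suc B@(suc _)) with ∃-floorRoot m B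
... | s , 1≤s , sᵐ≤B , B<[1+s]ᵐ with suc s ^ m ≤? suc B
... | yes [1+s]ᵐ≤ = suc s , s≤s z≤n , [1+s]ᵐ≤ , ≤-<-trans B<[1+s]ᵐ (^-monoˡ-< m ≤-refl)
... | no  [1+s]ᵐ≰ = s , 1≤s , m≤n⇒m≤1+n sᵐ≤B , ≰⇒> [1+s]ᵐ≰

^-cancel-< : ∀ k {m n} → m ^ k < n ^ k → m < n
^-cancel-< k {m} {n} mᵏ<nᵏ = ≰⇒> (λ n≤m → <⇒≱ mᵏ<nᵏ (^-monoˡ-≤ k n≤m))

-- As D^ω(n) ≤ D^D R(n), this makes (4^(10(1+ω(n))))^t at most rootConstant t * R n.
rootConstant : ℕ → ℕ
rootConstant t = D * D ^ D
  where D = 4 ^ (10 * t)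

rootConstant-nonZero : ∀ t → NonZero (rootConstant t)
rootConstant-nonZero t = m*n≢0 D (D ^ D) {{D≢0}} {{m^n≢0 D D {{D≢0}}}}
  where
  D = 4 ^ (10 * t)
  D≢0 = m^n≢0 4 (10 * t)

-- With B = ∏ R(nᵢ) and s = ⌊B^(1/φ(n))⌋ ≥ 1 one has B ≤ (2s)^φ(n).
floorRoot-bound : ∀ t .{{_ : NonZero t}} {n s} → 2 ≤ n → 1 ≤ s → product (map R (totatives n)) < suc s ^ φ n →
  n ^ t < R n * (2 * rootConstant t * s) ^ t
floorRoot-bound t {n} {s} 2≤n 1≤s Π<[1+s]ᵐ = begin-strict
  n ^ t                                   <⟨ ^-monoˡ-< t (^-cancel-< m (begin-strict
      n ^ m                                   ≤⟨ n^φ≤ 2≤n ⟩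
      E ^ m * Π                               <⟨ *-monoʳ-< (E ^ m) {{m^n≢0 E m}} Π<[1+s]ᵐ ⟩
      E ^ m * suc s ^ m                       ≤⟨ *-monoʳ-≤ (E ^ m) (^-monoˡ-≤ m 1+s≤2s) ⟩
      E ^ m * (2 * s) ^ m                     ≡⟨ ^-*-distrib E (2 * s) m ⟨
      (E * (2 * s)) ^ m                       ∎)) ⟩
  (E * (2 * s)) ^ t                       ≡⟨ ^-*-distrib E (2 * s) t ⟩
  E ^ t * (2 * s) ^ t                     ≤⟨ *-monoˡ-≤ ((2 * s) ^ t) E^t≤ ⟩
  -- Enlarging `A` to `A ^ t` leaves only `R n` outside the `t`-th power.
  A * R n * (2 * s) ^ t                   ≤⟨ *-monoˡ-≤ ((2 * s) ^ t) (*-monoˡ-≤ (R n) (A≤A^t t)) ⟩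
  A ^ t * R n * (2 * s) ^ t               ≡⟨ shuffle (A ^ t) (R n) _ ⟩
  R n * (A ^ t * (2 * s) ^ t)             ≡⟨ cong (R n *_) (^-*-distrib A (2 * s) t) ⟨
  R n * (A * (2 * s)) ^ t                 ≡⟨ cong (λ x → R n * x ^ t) (regroup A s) ⟩
  R n * (2 * A * s) ^ t                   ∎
  where
  open ≤-Reasoning
  m = φ n
  Π = product (map R (totatives n))
  A = rootConstant t
  D = 4 ^ (10 * t)
  E = 4 ^ (10 * suc (ω n))
  instance
    D≢0 : NonZero D
    D≢0 = m^n≢0 4 (10 * t)
    E≢0 : NonZero E
    E≢0 = m^n≢0 4 (10 * suc (ω n))
    A≢0 : NonZero A
    A≢0 = rootConstant-nonZero t
  1+s≤2s : suc s ≤ 2 * s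
  1+s≤2s = ≤-trans (+-monoˡ-≤ s 1≤s) (≤-reflexive (cong (_+_ s) (sym (+-identityʳ s))))
  E^t≤ : E ^ t ≤ A * R n
  E^t≤ = begin
    (4 ^ (10 * suc (ω n))) ^ t    ≡⟨ ^-*-assoc 4 (10 * suc (ω n)) t ⟩
    4 ^ (10 * suc (ω n) * t)      ≡⟨ cong (4 ^_) (swap (suc (ω n)) t) ⟩
    4 ^ (10 * t * suc (ω n))      ≡⟨ ^-*-assoc 4 (10 * t) (suc (ω n)) ⟨
    D * D ^ ω n                   ≤⟨ *-monoʳ-≤ D (D^ω≤D^D*R D n) ⟩
    D * (D ^ D * R n)             ≡⟨ *-assoc D (D ^ D) (R n) ⟨
    A * R n                       ∎
    where
    swap : ∀ a b → 10 * a * b ≡ 10 * b * a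
    swap = solve-∀
  A≤A^t : ∀ t .{{_ : NonZero t}} → A ≤ A ^ t
  A≤A^t (suc t) = m≤m*n A (A ^ t) {{m^n≢0 A t}}
  shuffle : ∀ a b c → a * b * c ≡ b * (a * c)
  shuffle = solve-∀
  regroup : ∀ a s → a * (2 * s) ≡ 2 * a * s
  regroup = solve-∀

-- Dedekind cuts of powers and products

ι : ℕ → ℚ
ι n = (+ n) / 1

toℚᵘ-ι : ∀ n → ℚ.toℚᵘ (ι n) ℚᵘ.≃ ℚᵘ.mkℚᵘ (+ n) 0
toℚᵘ-ι n = ℚₚ.toℚᵘ-fromℚᵘ (ℚᵘ.mkℚᵘ (+ n) 0)

ι-* : ∀ m n → ι (m * n) ≡ ι m *ℚ ι n
ι-* m n = ℚₚ.toℚᵘ-injective (begin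
  ℚ.toℚᵘ (ι (m * n))                        ≈⟨ toℚᵘ-ι (m * n) ⟩
  ℚᵘ.mkℚᵘ (+ (m * n)) 0                     ≡⟨ cong (λ i → ℚᵘ.mkℚᵘ i 0) (ℤₚ.pos-* m n) ⟩
  ℚᵘ.mkℚᵘ (+ m) 0 ℚᵘ.* ℚᵘ.mkℚᵘ (+ n) 0      ≈⟨ ℚᵘₚ.*-cong (toℚᵘ-ι m) (toℚᵘ-ι n) ⟨
  ℚ.toℚᵘ (ι m) ℚᵘ.* ℚ.toℚᵘ (ι n)            ≈⟨ ℚₚ.toℚᵘ-homo-* (ι m) (ι n) ⟨
  ℚ.toℚᵘ (ι m *ℚ ι n)                       ∎)
  where open ℚᵘₚ.≃-Reasoning

ι-^ : ∀ m k → ι (m ^ k) ≡ ι m ^ℚ k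
ι-^ m zero    = refl
ι-^ m (suc k) = trans (ι-* m (m ^ k)) (cong (ι m *ℚ_) (ι-^ m k))

ι-mono-< : ∀ {m n} → m < n → ι m <ℚ ι n
ι-mono-< {m} {n} m<n = ℚₚ.toℚᵘ-cancel-< (ℚᵘₚ.<-respˡ-≃ (ℚᵘₚ.≃-sym (toℚᵘ-ι m)) (ℚᵘₚ.<-respʳ-≃ (ℚᵘₚ.≃-sym (toℚᵘ-ι n))
  (ℚᵘ.*<* (ℤₚ.*-monoʳ-<-pos (+ 1) (ℤ.+<+ m<n)))))

ι-mono-≤ : ∀ {m n} → m ≤ n → ι m ≤ℚ ι n
ι-mono-≤ {m} {n} m≤n = ℚₚ.toℚᵘ-cancel-≤ (ℚᵘₚ.≤-respˡ-≃ (ℚᵘₚ.≃-sym (toℚᵘ-ι m)) (ℚᵘₚ.≤-respʳ-≃ (ℚᵘₚ.≃-sym (toℚᵘ-ι n))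
  (ℚᵘ.*≤* (ℤₚ.*-monoʳ-≤-nonNeg (+ 1) (ℤ.+≤+ m≤n)))))

1/m<r⇒↧r≤↥r*m : ∀ m .{{_ : NonZero m}} r → (+ 1) / m <ℚ r → (+ (↧ₙ r)) ℤ.≤ ↥ r ℤ.* + m
1/m<r⇒↧r≤↥r*m (suc m) r@(mkℚ _ _ _) 1/m<r = subst (ℤ._≤ ↥ r ℤ.* + suc m) (ℤₚ.*-identityˡ (+ (↧ₙ r))) (ℤₚ.<⇒≤ (ℚᵘₚ.drop-*<*
  (ℚᵘₚ.<-respˡ-≃ (ℚₚ.toℚᵘ-fromℚᵘ (ℚᵘ.mkℚᵘ (+ 1) m)) (ℚₚ.toℚᵘ-mono-< 1/m<r))))

-- Membership in the lower cut needs an exponent strictly below `1/m`, which is awkward to exhibit.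
-- Locatedness between `p` and `q` supplies it: the alternative would put `q` above `B ^ r` for some
-- `r > 1/m`, against `q ^ m ≤ B`.
L-root : ∀ B .{{_ : NonZero B}} m .{{_ : NonZero m}} {p q} →
  q ^ℚ m ≤ℚ ι B → p <ℚ q → ℝ.L (B ^ᴿ fromℚ ((+ 1) / m)) p
L-root B m {p} {q} qᵐ≤B p<q with ℝ.located (B ^ᴿ fromℚ ((+ 1) / m)) p<q
... | inj₁ p∈L = p∈L
... | inj₂ (r , 1/m<r , 0<q , B^r<q) = ⊥-elim (ℚₚ.<-irrefl refl (begin-strict
  q^t ^ℚ m                    ≡⟨ trans (^-assocʳ q t m) (trans (cong (q ^ℚ_) (*-comm t m)) (sym (^-assocʳ q m t))) ⟩
  (q ^ℚ m) ^ℚ t               ≤⟨ ℚ-Lemmas.^-mono-≤ t (ℚₚ.<⇒≤ (^-pos m 0<q)) qᵐ≤B ⟩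
  ι B ^ℚ t                    ≤⟨ ^ℤ-mono-≤ (1/m<r⇒↧r≤↥r*m m r 1/m<r) ⟩
  ι B ^ℤ (↥ r ℤ.* + m)        ≡⟨ ^ℤ-assoc (↥ r) m ⟨
  (ι B ^ℤ ↥ r) ^ℚ m           <⟨ ^ℚ-monoˡ-< m (ℚₚ.<⇒≤ (^ℤ-pos (↥ r))) B^r<q ⟩
  q^t ^ℚ m                    ∎))
  where
  open ℚₚ.≤-Reasoning
  t = ↧ₙ r
  q^t = q ^ℚ t
  instance
    B≢0 : ℚ.NonZero (ι B)
    B≢0 = ℚₚ.pos⇒nonZero (ι B) {{ℚₚ.normalize-pos B 1}}
  open ℤ-Power-Lemmas {ι B} (ι-mono-≤ (>-nonZero⁻¹ B))
  ^ℚ-monoˡ-< : ∀ m .{{_ : NonZero m}} {x y} → 0ℚ ≤ℚ x → x <ℚ y → x ^ℚ m <ℚ y ^ℚ m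
  ^ℚ-monoˡ-< (suc m) = ℚ-Lemmas.^-mono-< m

-- The exponent `-1/(t+1)` lies above `-θ`; as negation computes on `mkℚ`, the proof that `1/(t+1)`
-- lies below `θ` serves unchanged. What remains is `1/b < d^(t+1)`.
U-power-neg : ∀ b .{{_ : NonZero b}} θ t {d} → ℝ.L θ (mkℚ (+ 1) t (1-coprimeTo (suc t))) → 0ℚ <ℚ d →
  1ℚ <ℚ ι b *ℚ d ^ℚ suc t → ℝ.U (b ^ᴿ (-ᴿ θ)) d
U-power-neg b θ t {d} 1/t∈L 0<d 1<bdᵗ = mkℚ -[1+ 0 ] t (1-coprimeTo (suc t)) , 1/t∈L , 0<d ,
  ℚ-Lemmas.*-cancel-< {ι b} (ℚₚ.positive⁻¹ (ι b) {{ℚₚ.normalize-pos b 1}})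
    (subst (_<ℚ ι b *ℚ d ^ℚ suc t) (sym (trans (cong (ι b *ℚ_) (ℚₚ.*-identityʳ _)) (ℚₚ.*-inverseʳ (ι b)))) 1<bdᵗ)
  where
  instance
    b≢0 : ℚ.NonZero (ι b)
    b≢0 = ℚₚ.pos⇒nonZero (ι b) {{ℚₚ.normalize-pos b 1}}

-- In a box `[a, b] × [0, d]` with `a ≤ 0` two corners vanish and `a * d` is nonpositive, so `b * d`
-- is the only corner to control.
U-* : ∀ x y {b d q} → ℝ.U x b → ℝ.L y 0ℚ → ℝ.U y d → 0ℚ <ℚ q → b *ℚ d <ℚ q → ℝ.U (x *ᴿ y) q
U-* x y {b} {d} {q} b∈U 0∈L d∈U 0<q bd<q = box nonpositive
  where
  nonpositive : ∃ λ a → a ≤ℚ 0ℚ × ℝ.L x a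
  nonpositive with ℝ.L-inhabited x
  ... | a , a∈L with a ℚₚ.≤? 0ℚ
  ... | yes a≤0 = a , a≤0 , a∈L
  ... | no  a≰0 = 0ℚ , ℚₚ.≤-refl , ℝ.L-lower x (ℚₚ.≰⇒> a≰0) a∈L
  *0<q : ∀ z → z *ℚ 0ℚ <ℚ q
  *0<q z = subst (_<ℚ q) (sym (ℚₚ.*-zeroʳ z)) 0<q
  box : (∃ λ a → a ≤ℚ 0ℚ × ℝ.L x a) → ℝ.U (x *ᴿ y) q
  box (a , a≤0 , a∈L) = a , b , 0ℚ , d , (a∈L , b∈U , 0∈L , d∈U) , *0<q a , ad<q , *0<q b , bd<q
    where
    ad<q : a *ℚ d <ℚ q
    ad<q = ℚₚ.≤-<-trans (ℚₚ.≤-trans (ℚ-Lemmas.*-monoˡ-≤ (ℚₚ.<⇒≤ (ℝ-Lemmas.L<U y 0∈L d∈U)) a≤0) (ℚₚ.≤-reflexive (ℚₚ.*-zeroˡ d))) 0<q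

∃-unit-fraction-below : ∀ {p} → 0ℚ <ℚ p → ∃ λ t → mkℚ (+ 1) t (1-coprimeTo (suc t)) <ℚ p
∃-unit-fraction-below {mkℚ (+ 0)       d _} 0<p = ⊥-elim (ℤₚ.<-irrefl refl (ℚₚ.drop-*<* 0<p))
-- `mkℚ` stores the denominator minus one: `1/(d+2) < 1/(d+1) ≤ p`.
∃-unit-fraction-below {mkℚ (+ suc a)   d _} 0<p = suc d , ℚ.*<* (ℤ.+<+ (≤-trans (≤-reflexive (cong (_+_ 2) (+-identityʳ d))) (m≤m+n (2 + d) (a * (2 + d)))))
∃-unit-fraction-below {mkℚ -[1+ a ]    d _} 0<p = contradiction (ℚₚ.drop-*<* 0<p) (λ ())

scale-< : ∀ {m n x} → m < n → 0ℚ <ℚ x → ι m *ℚ x <ℚ ι n *ℚ x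
scale-< m<n 0<x = ℚ-Lemmas.*-monoˡ-< 0<x (ι-mono-< m<n)

x<2x : ∀ {x} → 0ℚ <ℚ x → x <ℚ ι 2 *ℚ x
x<2x {x} 0<x = subst (_<ℚ ι 2 *ℚ x) (ℚₚ.*-identityˡ x) (scale-< (<ᵇ⇒< 1 2 _) 0<x)

-- The rational witness 14ακs lies between 12ακs, which bounds the left-hand
-- side, and 16ακs = s, which bounds the right-hand side from below.
separate : ∀ θ t {κ n} (2≤n : 2 ≤ n) → ℝ.L θ (mkℚ (+ 1) t (1-coprimeTo (suc t))) →
  0ℚ <ℚ κ → ι 16 *ℚ ι (rootConstant (suc t)) *ℚ κ ≡ 1ℚ →
  fromℚ κ *ᴿ (_^ᴿ_ (R n) {{R-nonZero n}} (-ᴿ θ)) *ᴿ fromℕ n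
    <ᴿ _^ᴿ_ (product (map R (totatives n))) {{∏R-nonZero (totatives n)}} (fromℚ (((+ 1) / φ n) {{φ-nonZero 2≤n}}))
separate θ t-1 {κ} {n} 2≤n 1/t∈L 0<κ 16ακ≡1 = fromRoot (∃-floorRoot (φ n) B)
  where
  instance
    _ = φ-nonZero 2≤n
    _ = ∏R-nonZero (totatives n)
    _ = R-nonZero n
  t = suc t-1
  A = rootConstant t
  B = product (map R (totatives n))
  α = ι A
  ν = ι n
  Y = R n ^ᴿ (-ᴿ θ)
  0<α : 0ℚ <ℚ α
  0<α = ι-mono-< (>-nonZero⁻¹ A {{rootConstant-nonZero t}})
  0<ν : 0ℚ <ℚ ν
  0<ν = ι-mono-< (≤-trans (s≤s z≤n) 2≤n)
  0∈L : ℝ.L Y 0ℚ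
  0∈L = proj₁ (ℝ.L-inhabited (-ᴿ θ)) , proj₂ (ℝ.L-inhabited (-ᴿ θ)) , inj₁ ℚₚ.≤-refl

  fromRoot : (∃ λ s → 1 ≤ s × s ^ φ n ≤ B × B < suc s ^ φ n) →
    fromℚ κ *ᴿ Y *ᴿ fromℕ n <ᴿ B ^ᴿ fromℚ ((+ 1) / φ n)
  fromRoot (s , 1≤s , sᵐ≤B , B<[1+s]ᵐ) = ι 14 *ℚ v ,
    -- Cuts are strict, so each factor is enlarged: `κ` to `2κ`, then `2κd` to `3κd`, and `ν` to
    -- `2ν`. As `νd = 2ασ`, the product is `6κdν = 12ακσ`.
    U-* (fromℚ κ *ᴿ Y) (fromℕ n)
      (U-* (fromℚ κ) Y (x<2x 0<κ) 0∈L d∈U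
        (*-pos (*-pos (ℚₚ.positive⁻¹ (ι 3)) 0<κ) 0<d) (ℚ-Lemmas.*-monoˡ-< 0<d (scale-< (<ᵇ⇒< 2 3 _) 0<κ)))
      0<ν (x<2x 0<ν) (*-pos (ℚₚ.positive⁻¹ (ι 14)) 0<v)
      (subst (_<ℚ ι 14 *ℚ v) 12v≡ (scale-< (<ᵇ⇒< 12 14 _) 0<v)) ,
    L-root B (φ n) (ℚₚ.≤-trans (ℚₚ.≤-reflexive (sym (ι-^ s (φ n)))) (ι-mono-≤ sᵐ≤B))
      (subst (ι 14 *ℚ v <ℚ_) 16v≡s (scale-< (<ᵇ⇒< 14 16 _) 0<v))
    where
    σ v d : ℚ
    σ = ι s
    v = α *ℚ κ *ℚ σ
    0<σ : 0ℚ <ℚ σ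
    0<σ = ι-mono-< 1≤s
    0<v : 0ℚ <ℚ v
    0<v = *-pos (*-pos 0<α 0<κ) 0<σ
    -- `d = 2As/n` is chosen so that `floorRoot-bound`, divided by `n ^ t`, says `1 < R n * d ^ t`.
    d = proj₁ (quot (ι (2 * A * s)) 0<ν)
    νd≡2As : ν *ℚ d ≡ ι (2 * A * s)
    νd≡2As = proj₂ (quot (ι (2 * A * s)) 0<ν)
    νd≡2ασ : ν *ℚ d ≡ ι 2 *ℚ α *ℚ σ
    νd≡2ασ = trans νd≡2As (trans (ι-* (2 * A) s) (cong (_*ℚ σ) (ι-* 2 A)))
    0<d : 0ℚ <ℚ d
    0<d = quot-pos 0<ν νd≡2ασ (*-pos (*-pos (ℚₚ.positive⁻¹ (ι 2)) 0<α) 0<σ)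

    d∈U : ℝ.U Y d
    d∈U = U-power-neg (R n) θ t-1 1/t∈L 0<d (ℚ-Lemmas.*-cancel-< (^-pos t 0<ν) (begin-strict
      ν ^ℚ t *ℚ 1ℚ                        ≡⟨ ℚₚ.*-identityʳ _ ⟩
      ν ^ℚ t                              ≡⟨ ι-^ n t ⟨
      ι (n ^ t)                           <⟨ ι-mono-< (floorRoot-bound t 2≤n 1≤s B<[1+s]ᵐ) ⟩
      ι (R n * (2 * A * s) ^ t)           ≡⟨ trans (ι-* (R n) ((2 * A * s) ^ t)) (cong (ι (R n) *ℚ_) (ι-^ (2 * A * s) t)) ⟩
      ι (R n) *ℚ ι (2 * A * s) ^ℚ t       ≡⟨ cong (λ x → ι (R n) *ℚ x ^ℚ t) νd≡2As ⟨
      ι (R n) *ℚ (ν *ℚ d) ^ℚ t            ≡⟨ cong (ι (R n) *ℚ_) (^-distrib-* ν d t) ⟩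
      ι (R n) *ℚ (ν ^ℚ t *ℚ d ^ℚ t)       ≡⟨ shuffle (ι (R n)) (ν ^ℚ t) (d ^ℚ t) ⟩
      ν ^ℚ t *ℚ (ι (R n) *ℚ d ^ℚ t)       ∎))
      where
      open ℚₚ.≤-Reasoning
      shuffle : ∀ x y z → x *ℚ (y *ℚ z) ≡ y *ℚ (x *ℚ z)
      shuffle = solve 3 (λ x y z → x :* (y :* z) := y :* (x :* z)) refl where open +-*-Solver

    12v≡ : ι 12 *ℚ v ≡ ι 3 *ℚ κ *ℚ d *ℚ (ι 2 *ℚ ν)
    12v≡ = trans (regroup κ α σ) (trans (cong (ι 6 *ℚ κ *ℚ_) (sym νd≡2ασ)) (regroup′ κ ν d))
      where
      open +-*-Solver
      regroup : ∀ κ α σ → ι 12 *ℚ (α *ℚ κ *ℚ σ) ≡ ι 6 *ℚ κ *ℚ (ι 2 *ℚ α *ℚ σ)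
      regroup = solve 3 (λ κ α σ → con (ι 12) :* (α :* κ :* σ) := con (ι 6) :* κ :* (con (ι 2) :* α :* σ)) refl
      regroup′ : ∀ κ ν d → ι 6 *ℚ κ *ℚ (ν *ℚ d) ≡ ι 3 *ℚ κ *ℚ d *ℚ (ι 2 *ℚ ν)
      regroup′ = solve 3 (λ κ ν d → con (ι 6) :* κ :* (ν :* d) := con (ι 3) :* κ :* d :* (con (ι 2) :* ν)) refl
    16v≡s : ι 16 *ℚ v ≡ σ
    16v≡s = trans (assoc (ι 16) α κ σ) (trans (cong (_*ℚ σ) 16ακ≡1) (ℚₚ.*-identityˡ σ))
      where
      open +-*-Solver
      assoc : ∀ c α κ σ → c *ℚ (α *ℚ κ *ℚ σ) ≡ c *ℚ α *ℚ κ *ℚ σ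
      assoc = solve 4 (λ c α κ σ → c :* (α :* κ :* σ) := c :* α :* κ :* σ) refl

mainTheorem1 : (θ : ℝ) → 0ᴿ <ᴿ θ →
    Σ[ K ∈ ℝ ] (0ᴿ <ᴿ K) ×
    (∀ n → (2≤n : 2 ≤ n) →
    K *ᴿ (_^ᴿ_ (R n) {{R-nonZero n}} (-ᴿ θ)) *ᴿ fromℕ n
    <ᴿ _^ᴿ_ (product (map R (totatives n))) {{∏R-nonZero (totatives n)}}
    (fromℚ (((+ 1) / φ n) {{φ-nonZero 2≤n}})))
mainTheorem1 θ (p , 0<p , p∈L) =
  -- `t`, and with it `κ = 1/(16A)`, is fixed from `θ` before `n` appears.
  fromℚ κ , ℚₚ.<-dense 0<κ , λ n 2≤n → separate θ t 2≤n (ℝ.L-lower θ (proj₂ unitFraction) p∈L) 0<κ (proj₂ κ∃)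
  where
  unitFraction = ∃-unit-fraction-below 0<p
  t = proj₁ unitFraction
  0<16α : 0ℚ <ℚ ι 16 *ℚ ι (rootConstant (suc t))
  0<16α = *-pos (ℚₚ.positive⁻¹ (ι 16)) (ι-mono-< (>-nonZero⁻¹ _ {{rootConstant-nonZero (suc t)}}))
  κ∃ = quot 1ℚ 0<16α
  κ = proj₁ κ∃
  0<κ : 0ℚ <ℚ κ
  0<κ = quot-pos 0<16α (proj₂ κ∃) ℚ-Lemmas.0<1
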